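{- Let $G$ be a connected edge-transitive graph that is not a star. Then every induced path of length at most $3$ in $G$ closes to an induced cycle. Moreover, for every integer $\ell\geq 4$, there exists a connected edge-transitive graph containing an induced path of length $\ell$ not contained in any induced cycle.
   Context: All graphs are finite, simple and undirected. A star is a complete bipartite graph $K_{1,n}$ for some $n\ge 0$. A graph is edge-transitive if for every two edges $e,f$ there is an automorphism mapping $e$ to $f$. A path of length $\ell$ in $G$ is a sequence $(x_0,\dots,x_\ell)$ of pairwise distinct vertices with $x_i x_{i+1}\in E(G)$ for $0\le i\le \ell-1$ (length $0$ means a single vertex). A cycle is a sequence $(x_0,\dots,x_{\ell-1},x_\ell=x_0)$ with $\ell\ge 3$, $x_0,\dots,x_{\ell-1}$ pairwise distinct and consecutive vertices adjacent. Paths and cycles are identified with the subgraphs formed by their vertices and edges; they are induced if this subgraph is an induced subgraph of $G$. An induced path $P$ closes to an induced cycle if there is an induced cycle $C$ in $G$ such that $P$ is an induced subgraph of $C$. -}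

module Defs where

open import Data.Nat using (ℕ; zero; suc; _≤_)
open import Data.Fin using (Fin; toℕ)
open import Data.Fin.Permutation using (Permutation′; _⟨$⟩ʳ_)
open import Data.Bool using (Bool; true; false)
open import Data.Product using (Σ; ∃; ∃-syntax; _×_; _,_)
open import Data.Sum using (_⊎_)
open import Relation.Binary.PropositionalEquality using (_≡_; _≢_)
open import Function.Definitions using (Injective)
open import Function.Bundles using (_⇔_)

record Graph (n : ℕ) : Set where
  field
    adj    : Fin n → Fin n → Bool
    sym    : ∀ u v → adj u v ≡ adj v u
    irrefl : ∀ v → adj v v ≡ false
open Graph public

Adj : {n : ℕ} → Graph n → Fin n → Fin n → Set
Adj G u v = adj G u v ≡ true

data Walk {n : ℕ} (G : Graph n) : Fin n → Fin n → Set where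
  here : ∀ {v} → Walk G v v
  step : ∀ {u w v} → Adj G u w → Walk G w v → Walk G u v

Connected : {n : ℕ} → Graph n → Set
Connected G = ∀ u v → Walk G u v

IsAutomorphism : {n : ℕ} → Graph n → Permutation′ n → Set
IsAutomorphism G σ = ∀ u v → adj G (σ ⟨$⟩ʳ u) (σ ⟨$⟩ʳ v) ≡ adj G u v

EdgeTransitive : {n : ℕ} → Graph n → Set
EdgeTransitive {n} G =
  ∀ a b c d → Adj G a b → Adj G c d →
  Σ (Permutation′ n) λ σ → IsAutomorphism G σ ×
    ((σ ⟨$⟩ʳ a ≡ c × σ ⟨$⟩ʳ b ≡ d) ⊎ (σ ⟨$⟩ʳ a ≡ d × σ ⟨$⟩ʳ b ≡ c))

-- G is a star K_{1,m} (m ≥ 0): there is a centre c such that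
-- u,v are adjacent iff exactly one of them is c.
IsStar : {n : ℕ} → Graph n → Set
IsStar {n} G = Σ (Fin n) λ c → ∀ u v →
  Adj G u v ⇔ ((u ≡ c × v ≢ c) ⊎ (v ≡ c × u ≢ c))

PathIdxAdj : {ℓ : ℕ} → Fin (suc ℓ) → Fin (suc ℓ) → Set
PathIdxAdj i j = suc (toℕ i) ≡ toℕ j ⊎ suc (toℕ j) ≡ toℕ i

IsPath : {n : ℕ} (G : Graph n) (ℓ : ℕ) → (Fin (suc ℓ) → Fin n) → Set
IsPath G ℓ p = Injective _≡_ _≡_ p × (∀ i j → PathIdxAdj i j → Adj G (p i) (p j))

IsInducedPath : {n : ℕ} (G : Graph n) (ℓ : ℕ) → (Fin (suc ℓ) → Fin n) → Set
IsInducedPath G ℓ p = IsPath G ℓ p × (∀ i j → Adj G (p i) (p j) → PathIdxAdj i j)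

CycIdxAdj₁ : {k : ℕ} → Fin k → Fin k → Set
CycIdxAdj₁ {k} i j = suc (toℕ i) ≡ toℕ j ⊎ (suc (toℕ i) ≡ k × toℕ j ≡ 0)

CycIdxAdj : {k : ℕ} → Fin k → Fin k → Set
CycIdxAdj i j = CycIdxAdj₁ i j ⊎ CycIdxAdj₁ j i

IsCycle : {n : ℕ} (G : Graph n) (k : ℕ) → (Fin k → Fin n) → Set
IsCycle G k c = 3 ≤ k × Injective _≡_ _≡_ c × (∀ i j → CycIdxAdj i j → Adj G (c i) (c j))

IsInducedCycle : {n : ℕ} (G : Graph n) (k : ℕ) → (Fin k → Fin n) → Set
IsInducedCycle G k c = IsCycle G k c × (∀ i j → Adj G (c i) (c j) → CycIdxAdj i j)

PathEdge : {n ℓ : ℕ} → (Fin (suc ℓ) → Fin n) → Fin n → Fin n → Set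
PathEdge p u v = ∃[ i ] ∃[ j ] (PathIdxAdj i j × p i ≡ u × p j ≡ v)

CycleEdge : {n k : ℕ} → (Fin k → Fin n) → Fin n → Fin n → Set
CycleEdge c u v = ∃[ i ] ∃[ j ] (CycIdxAdj i j × c i ≡ u × c j ≡ v)

PathInducedSubOfCycle : {n ℓ k : ℕ} → (Fin (suc ℓ) → Fin n) → (Fin k → Fin n) → Set
PathInducedSubOfCycle p c =
  (∀ i → ∃[ j ] (p i ≡ c j)) ×
  (∀ i j → CycleEdge c (p i) (p j) ⇔ PathEdge p (p i) (p j))

ClosesToInducedCycle : {n : ℕ} (G : Graph n) (ℓ : ℕ) → (Fin (suc ℓ) → Fin n) → Set
ClosesToInducedCycle G ℓ p =
  ∃[ k ] Σ (Fin k → Fin _) λ c → IsInducedCycle G k c × PathInducedSubOfCycle p c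

{-# OPTIONS --safe #-}

-- An edge bc is avoidable if every induced path abcd with middle edge bc closes to an induced cycle.
-- Every graph with an edge has an avoidable one: take a connected set U, maximal such that some edge
-- survives in G − N[U], and recurse into G − N[U]. By edge-transitivity all edges are then avoidable,
-- which is the case ℓ = 3. An induced path abc that neither extends to an induced path abcd nor closes
-- to a 4-cycle satisfies N[c] ⊊ N[b]; this inclusion is inherited by all edges, excludes triangles and
-- makes c a leaf, so G is a star. Shorter paths extend or lie on a triangle unless G is a star.
--
-- For ℓ ≥ 4 the paths are trapped at their first vertex p₀: every neighbour of p₀ is adjacent to an
-- interior vertex. For ℓ = 4 such a path exists in the Paley graph on 13 vertices, and for ℓ ≥ 5 in the
-- incidence graph between ℓ + 3 points and the ordered triples of distinct points.
module Submission where

open import Defs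
open import Data.Bool as Bool using (Bool; true; false)
open import Data.Empty using (⊥-elim)
open import Data.Empty.Irrelevant using () renaming (⊥-elim to ⊥-elim-irr)
open import Data.Fin using (Fin; zero; suc; toℕ; fromℕ; fromℕ<; inject₁)
open import Data.Fin.Induction using (spo-noetherian)
open import Data.Fin.Patterns
open import Data.Fin.Permutation as Perm using (Permutation′; _⟨$⟩ʳ_; _⟨$⟩ˡ_; _∘ₚ_; flip; transpose)
open import Data.Fin.Properties
  using (_≟_; any?; all?; toℕ-injective; toℕ-fromℕ; suc-injective; toℕ-fromℕ<; fromℕ<-injective;
         toℕ<n; toℕ-inject₁; +↔⊎; *↔×)
open import Data.Fin.Subset using (Subset; _∈_; _∉_; _⊂_; _⊃_; _∪_; ⁅_⁆; ⊤)
open import Data.Fin.Subset.Induction using (⊂-wellFounded; ⊃-wellFounded)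
open import Data.Fin.Subset.Properties
  using (_∈?_; ∈⊤; x∈⁅x⁆; x∈⁅y⁆⇒x≡y; x∈p∪q⁻; x∈p∪q⁺; q⊆p∪q)
open import Data.Irrelevant using (Irrelevant; [_])
open import Data.List using (List; []; _∷_)
open import Data.List.Relation.Unary.All using (All; []; _∷_)
open import Data.Nat using (ℕ; zero; suc; _≤_; _<_; _+_; _*_; _∸_; z≤n; s≤s; s≤s⁻¹)
open import Data.Nat.DivMod using (_mod_; _%_)
import Data.Nat.Properties as ℕ
open import Data.Product using (Σ; ∃-syntax; _×_; _,_; proj₁; proj₂)
open import Data.Product.Function.NonDependent.Propositional using (_×-↔_)
open import Data.Refinement as Refinement using (Refinement; value) renaming (_,_ to _,ᴿ_)
open import Data.Refinement.Properties using (value-injective)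
open import Data.Sum as Sum using (_⊎_; inj₁; inj₂)
open import Data.Sum.Function.Propositional using (_⊎-↔_)
open import Data.Sum.Properties using (inj₁-injective; inj₂-injective)
import Data.Vec as Vec
open import Data.Vec.Functional as VF using (Vector; tail)
open import Data.Vec.Properties using (lookup∘tabulate; lookup⇒[]=; []=⇒lookup)
open import Function using (_∘_; case_of_; mk⇔; mk↔ₛ′; Equivalence; Inverse; _↔_; _⇔_)
open import Function.Definitions using (Injective)
open import Function.Properties.Inverse using (↔-refl; ↔-sym; ↔-trans)
open import Induction.WellFounded using (Acc; acc)
open import Level using (0ℓ)
open import Relation.Binary.Construct.Closure.ReflexiveTransitive as Star using (Star; ε; _◅_; _◅◅_)
open import Relation.Binary.PropositionalEquality
  using (_≡_; _≢_; refl; trans; cong; cong₂; subst; subst₂; isEquivalence; resp₂)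
  renaming (sym to ≡-sym)
open import Relation.Binary.Structures using (IsStrictPartialOrder)
open import Relation.Nullary using (¬_; Dec; yes; no; does)
open import Relation.Nullary.Decidable
  using (_×-dec_; _⊎-dec_; _→-dec_; ¬?; dec-true; dec-false; from-yes; does-⇔; map′;
         recompute; decidable-stable)
open import Relation.Unary using (Pred; Decidable)

-- Vectors and decidable subsets

infixr 5 _∷ᵥ_
_∷ᵥ_ : ∀ {A : Set} {k} → A → Vector A k → Vector A (suc k)
_∷ᵥ_ = VF._∷_

∷ᵥ-injective : ∀ {A : Set} {k} {x : A} {q : Vector A k} → Injective _≡_ _≡_ q → (∀ i → x ≢ q i) →
  Injective _≡_ _≡_ (x ∷ᵥ q)
∷ᵥ-injective inj x∉q {zero}  {zero}  _  = refl
∷ᵥ-injective inj x∉q {zero}  {suc j} eq = ⊥-elim (x∉q j eq)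
∷ᵥ-injective inj x∉q {suc i} {zero}  eq = ⊥-elim (x∉q i (≡-sym eq))
∷ᵥ-injective inj x∉q {suc i} {suc j} eq = cong suc (inj eq)

subsetOf : ∀ {n} {P : Pred (Fin n) 0ℓ} → Decidable P → Subset n
subsetOf P? = Vec.tabulate (does ∘ P?)

∈-subsetOf⁺ : ∀ {n} {P : Pred (Fin n) 0ℓ} (P? : Decidable P) {v} → P v → v ∈ subsetOf P?
∈-subsetOf⁺ P? {v} Pv = lookup⇒[]= v _ (trans (lookup∘tabulate (does ∘ P?) v) (dec-true (P? v) Pv))

∈-subsetOf⁻ : ∀ {n} {P : Pred (Fin n) 0ℓ} (P? : Decidable P) {v} → v ∈ subsetOf P? → P v
∈-subsetOf⁻ P? {v} v∈ with P? v | trans (≡-sym (lookup∘tabulate (does ∘ P?) v)) ([]=⇒lookup v∈)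
... | yes Pv | _ = Pv

module InducedPaths {n : ℕ} (G : Graph n) where

  private
    _~_ : Fin n → Fin n → Set
    _~_ = Adj G

  ~-sym : ∀ {u v} → u ~ v → v ~ u
  ~-sym {u} {v} = trans (Graph.sym G v u)

  ~⇒≢ : ∀ {u v} → u ~ v → u ≢ v
  ~⇒≢ {u} u~u refl with trans (≡-sym u~u) (irrefl G u)
  ... | ()

  _~?_ : ∀ u v → Dec (u ~ v)
  u ~? v = adj G u v Bool.≟ true

  automorphism-~ : ∀ σ → IsAutomorphism G σ → ∀ {u v} → u ~ v → (σ ⟨$⟩ʳ u) ~ (σ ⟨$⟩ʳ v)
  automorphism-~ σ aut = trans (aut _ _)

  automorphism-~⁻ : ∀ σ → IsAutomorphism G σ → ∀ {u v} → (σ ⟨$⟩ʳ u) ~ v → u ~ (σ ⟨$⟩ˡ v)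
  automorphism-~⁻ σ aut {u} {v} σu~v =
    trans (≡-sym (aut _ _)) (subst ((σ ⟨$⟩ʳ u) ~_) (≡-sym (Perm.inverseʳ σ)) σu~v)

  -- Induced paths and cycles

  singleton-induced : ∀ v → IsInducedPath G 0 (v ∷ᵥ VF.[])
  singleton-induced v =
    ((λ { {0F} {0F} _ → refl }) , (λ { 0F 0F (inj₁ ()) ; 0F 0F (inj₂ ()) })) ,
    λ { 0F 0F v~v → ⊥-elim (~⇒≢ v~v refl) }

  tail-induced : ∀ {m} {q : Vector (Fin n) (suc (suc m))} →
    IsInducedPath G (suc m) q → IsInducedPath G m (tail q)
  tail-induced ((inj , edges) , chordless) =
    (suc-injective ∘ inj ,
     λ i j → edges (suc i) (suc j) ∘ Sum.map (cong suc) (cong suc)) ,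
    λ i j → Sum.map ℕ.suc-injective ℕ.suc-injective ∘ chordless (suc i) (suc j)

  cons-induced : ∀ {m} {q : Vector (Fin n) (suc m)} {u} → IsInducedPath G m q →
    (∀ i → u ≢ q i) → u ~ q zero → (∀ i → ¬ u ~ q (suc i)) →
    IsInducedPath G (suc m) (u ∷ᵥ q)
  cons-induced {m} {q} {u} ((inj , edges) , chordless) u∉q u~q₀ u≁q =
    (∷ᵥ-injective inj u∉q , edges′) , chordless′
    where
    edges′ : ∀ i j → PathIdxAdj i j → (u ∷ᵥ q) i ~ (u ∷ᵥ q) j
    edges′ zero          (suc zero)    _        = u~q₀
    edges′ (suc zero)    zero          _        = ~-sym u~q₀
    edges′ (suc i)       (suc j)       i-j      =
      edges i j (Sum.map ℕ.suc-injective ℕ.suc-injective i-j)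
    edges′ zero          zero          (inj₁ ())
    edges′ zero          zero          (inj₂ ())
    edges′ zero          (suc (suc _)) (inj₁ ())
    edges′ zero          (suc (suc _)) (inj₂ ())
    edges′ (suc (suc _)) zero          (inj₁ ())
    edges′ (suc (suc _)) zero          (inj₂ ())

    chordless′ : ∀ i j → (u ∷ᵥ q) i ~ (u ∷ᵥ q) j → PathIdxAdj i j
    chordless′ zero          zero          u~u = ⊥-elim (~⇒≢ u~u refl)
    chordless′ zero          (suc zero)    _   = inj₁ refl
    chordless′ zero          (suc (suc j)) u~q = ⊥-elim (u≁q j u~q)
    chordless′ (suc zero)    zero          _   = inj₂ refl
    chordless′ (suc (suc i)) zero          q~u = ⊥-elim (u≁q i (~-sym q~u))
    chordless′ (suc i)       (suc j)       q~q = Sum.map (cong suc) (cong suc) (chordless i j q~q)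

  -- The only wrap-around edge of the cycle joins `x` to the last vertex of `q`, and the chords at
  -- `x` are excluded by `ends`. As `q` has at least two vertices, the cycle has length at least 3.
  close-inducedPath : ∀ {m} {q : Vector (Fin n) (suc (suc m))} {x} → IsInducedPath G (suc m) q →
    (∀ i → x ≢ q i) → x ~ q zero → x ~ q (fromℕ (suc m)) →
    (∀ i → x ~ q i → i ≡ zero ⊎ i ≡ fromℕ (suc m)) →
    IsInducedCycle G (suc (suc (suc m))) (x ∷ᵥ q)
  close-inducedPath {m} {q} {x} ((inj , edges) , chordless) x∉q x~first x~last ends =
    (s≤s (s≤s (s≤s z≤n)) , ∷ᵥ-injective inj x∉q , edges′) , chordless′
    where
    edge₁ : ∀ i j → CycIdxAdj₁ i j → (x ∷ᵥ q) i ~ (x ∷ᵥ q) j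
    edge₁ zero    (suc zero) _ = x~first
    edge₁ (suc i) (suc j) (inj₁ eq) = edges i j (inj₁ (ℕ.suc-injective eq))
    edge₁ (suc i) zero    (inj₂ (eq , _)) = ~-sym (subst (λ i → x ~ q i) last≡i x~last)
      where
      last≡i : fromℕ (suc m) ≡ i
      last≡i = toℕ-injective (trans (toℕ-fromℕ (suc m))
        (ℕ.suc-injective (ℕ.suc-injective (≡-sym eq))))
    edge₁ zero    zero          (inj₁ ())
    edge₁ zero    zero          (inj₂ (() , _))
    edge₁ zero    (suc (suc _)) (inj₁ ())
    edge₁ zero    (suc (suc _)) (inj₂ (_ , ()))
    edge₁ (suc _) zero          (inj₁ ())
    edge₁ (suc _) (suc _)       (inj₂ (_ , ()))

    edges′ : ∀ i j → CycIdxAdj i j → (x ∷ᵥ q) i ~ (x ∷ᵥ q) j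
    edges′ i j (inj₁ i→j) = edge₁ i j i→j
    edges′ i j (inj₂ j→i) = ~-sym (edge₁ j i j→i)

    end : ∀ i → i ≡ zero ⊎ i ≡ fromℕ (suc m) → CycIdxAdj zero (suc i)
    end i (inj₁ refl) = inj₁ (inj₁ refl)
    end i (inj₂ refl) = inj₂ (inj₂ (cong (λ k → suc (suc k)) (toℕ-fromℕ (suc m)) , refl))

    chordless′ : ∀ i j → (x ∷ᵥ q) i ~ (x ∷ᵥ q) j → CycIdxAdj i j
    chordless′ zero    zero    x~x = ⊥-elim (~⇒≢ x~x refl)
    chordless′ zero    (suc j) x~q = end j (ends j x~q)
    chordless′ (suc i) zero    q~x = Sum.swap (end i (ends i (~-sym q~x)))
    chordless′ (suc i) (suc j) q~q =
      Sum.map (inj₁ ∘ cong suc) (inj₁ ∘ cong suc) (chordless i j q~q)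

  InducedPathWithin : (Fin n → Set) → Fin n → Fin n → Set
  InducedPathWithin P u v = ∃[ m ] Σ (Vector (Fin n) (suc m)) λ q →
    IsInducedPath G m q × q zero ≡ u × q (fromℕ m) ≡ v × (∀ i → P (q i))

  Within : (Fin n → Set) → Fin n → Fin n → Set
  Within P u v = u ~ v × P u × P v

  Within-sym : ∀ {P u v} → Within P u v → Within P v u
  Within-sym (u~v , Pu , Pv) = ~-sym u~v , Pv , Pu

  -- All of `q` before the last vertex equal or adjacent to `u` is cut off. The rest either starts
  -- at `u` or has its first vertex as the only neighbour of `u`, so that it can be extended by `u`.
  prepend : ∀ {P : Fin n → Set} {u} m (q : Vector (Fin n) (suc m)) → IsInducedPath G m q →
    (∀ i → P (q i)) → P u → ∃[ i ] (u ≡ q i ⊎ u ~ q i) → InducedPathWithin P u (q (fromℕ m))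
  prepend {P} {u} m q induced Pq Pu = go m q induced Pq
    where
    Touches : ∀ {k} → Vector (Fin n) k → Set
    Touches q = ∃[ i ] (u ≡ q i ⊎ u ~ q i)

    touches? : ∀ {k} (q : Vector (Fin n) k) → Dec (Touches q)
    touches? q = any? λ i → (u ≟ q i) ⊎-dec (u ~? q i)

    join : ∀ m q → IsInducedPath G m q → (∀ i → P (q i)) → ¬ Touches (tail q) →
      u ≡ q zero ⊎ u ~ q zero → InducedPathWithin P u (q (fromℕ m))
    join m q ind Pq _       (inj₁ u≡q₀) = m , q , ind , ≡-sym u≡q₀ , refl , Pq
    join m q ind Pq untouched (inj₂ u~q₀) =
      suc m , u ∷ᵥ q ,
      cons-induced ind
        (λ { zero → ~⇒≢ u~q₀ ; (suc i) u≡q → untouched (i , inj₁ u≡q) })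
        u~q₀ (λ i u~q → untouched (i , inj₂ u~q)) ,
      refl , refl , λ { zero → Pu ; (suc i) → Pq i }

    go : ∀ m q → IsInducedPath G m q → (∀ i → P (q i)) → Touches q →
      InducedPathWithin P u (q (fromℕ m))
    go zero    q ind Pq (zero , t) = join zero q ind Pq (λ ()) t
    go (suc m) q ind Pq t with touches? (tail q)
    ... | yes t′ = go m (tail q) (tail-induced ind) (Pq ∘ suc) t′
    go (suc m) q ind Pq (zero  , t) | no ¬t′ = join (suc m) q ind Pq ¬t′ t
    go (suc m) q ind Pq (suc i , t) | no ¬t′ = ⊥-elim (¬t′ (i , t))

  -- Induction along the walk; each further vertex is put in front and may skip a stretch of the
  -- path built so far.
  shortcut : ∀ {P u v} → P u → Star (Within P) u v → InducedPathWithin P u v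
  shortcut {u = u} Pu ε = 0 , u ∷ᵥ VF.[] , singleton-induced u , refl , refl , λ { 0F → Pu }
  shortcut Pu ((u~w , _ , Pw) ◅ walk) with shortcut Pw walk
  ... | m , q , ind , refl , refl , Pq = prepend m q ind Pq Pu (zero , inj₂ u~w)

  -- Keeping the vertices in a list lets a cycle found for a long path be reused for its shorter
  -- pieces.
  OnInducedCycle : List (Fin n) → Set
  OnInducedCycle vs =
    ∃[ k ] Σ (Fin k → Fin n) λ c → IsInducedCycle G k c × All (λ v → ∃[ j ] v ≡ c j) vs

  -- Path and cycle are both induced in `G`, so on the vertices of `p` the edges of either are
  -- exactly the adjacencies of `G`. The argument `cover` says that `vs` lists all vertices of `p`.
  inducedPath-closes : ∀ {ℓ p vs} → IsInducedPath G ℓ p → OnInducedCycle vs →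
    (∀ {Q : Fin n → Set} → All Q vs → ∀ i → Q (p i)) → ClosesToInducedCycle G ℓ p
  inducedPath-closes {p = p} ((_ , edges) , chordless) (k , c , cyc@((_ , _ , cedges) , cchordless) , on) cover =
    k , c , cyc , on′ , λ i j → mk⇔ to (from i j)
    where
    on′ = cover on

    to : ∀ {i j} → CycleEdge c (p i) (p j) → PathEdge p (p i) (p j)
    to {i} {j} (i′ , j′ , i′-j′ , ci′≡pi , cj′≡pj) with cedges i′ j′ i′-j′
    ... | e rewrite ci′≡pi | cj′≡pj = i , j , chordless i j e , refl , refl

    from : ∀ i j → PathEdge p (p i) (p j) → CycleEdge c (p i) (p j)
    from i j (i₁ , j₁ , i₁-j₁ , eqi , eqj) with on′ i | on′ j | edges i₁ j₁ i₁-j₁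
    ... | i′ , pi≡ci′ | j′ , pj≡cj′ | e rewrite eqi | eqj | pi≡ci′ | pj≡cj′ =
      i′ , j′ , cchordless i′ j′ e , refl , refl

  -- Avoidable edges

  -- Together with `b ~ c` this says that a b c d is an induced path; `a` and `d` differ because of
  -- `a~b` and `b≁d`.
  record Flanks (b c a d : Fin n) : Set where
    constructor flanks
    field
      a~b : a ~ b
      c~d : c ~ d
      a≢c : a ≢ c
      b≢d : b ≢ d
      a≁c : ¬ a ~ c
      b≁d : ¬ b ~ d
      a≁d : ¬ a ~ d

  -- The vertices that a connection from `a` to `d` may use if `b` and `c` are to close it without
  -- chords.
  record Clear (b c a d v : Fin n) : Set where
    constructor clear
    field
      v≢b : v ≢ b
      v≢c : v ≢ c
      b~v⇒v≡a : b ~ v → v ≡ a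
      c~v⇒v≡d : c ~ v → v ≡ d

  -- A walk is enough: `shortcut` makes it an induced path, which `b` and `c` complete to an induced
  -- cycle.
  Avoidable : Fin n → Fin n → Set
  Avoidable b c = ∀ {a d} → Flanks b c a d → Star (Within (Clear b c a d)) a d

  -- Only the flanks are confined to `S`. The walk may use all of `G`, so that a connected set
  -- removed earlier can carry it.
  AvoidableIn : Subset n → Fin n → Fin n → Set
  AvoidableIn S b c = ∀ {a d} → a ∈ S → d ∈ S → Flanks b c a d → Star (Within (Clear b c a d)) a d

  flank-clear : ∀ {b c a d} → Flanks b c a d → Clear b c a d a
  flank-clear (flanks a~b _ a≢c _ a≁c _ _) =
    clear (~⇒≢ a~b) a≢c (λ _ → refl) (λ c~a → ⊥-elim (a≁c (~-sym c~a)))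

  Flanks-sym : ∀ {b c a d} → Flanks b c a d → Flanks c b d a
  Flanks-sym (flanks a~b c~d a≢c b≢d a≁c b≁d a≁d) =
    flanks (~-sym c~d) (~-sym a~b) (b≢d ∘ ≡-sym) (a≢c ∘ ≡-sym) (b≁d ∘ ~-sym) (a≁c ∘ ~-sym) (a≁d ∘ ~-sym)

  Clear-sym : ∀ {b c a d v} → Clear b c a d v → Clear c b d a v
  Clear-sym (clear v≢b v≢c b~v c~v) = clear v≢c v≢b c~v b~v

  Avoidable-sym : ∀ {b c} → Avoidable b c → Avoidable c b
  Avoidable-sym avoid fl =
    Star.map (λ { (e , P , Q) → e , Clear-sym P , Clear-sym Q })
      (Star.reverse Within-sym (avoid (Flanks-sym fl)))

  -- This is S minus N[U], the set into which the recursion descends.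
  Free : Subset n → Subset n → Fin n → Set
  Free S U v = v ∈ S × v ∉ U × (∀ u → u ∈ U → ¬ u ~ v)

  free? : ∀ S U → Decidable (Free S U)
  free? S U v = (v ∈? S) ×-dec ¬? (v ∈? U) ×-dec all? λ u → (u ∈? U) →-dec ¬? (u ~? v)

  HasEdge : (Fin n → Set) → Set
  HasEdge P = ∃[ b ] ∃[ c ] (P b × P c × b ~ c)

  hasEdge? : ∀ {P} → Decidable P → Dec (HasEdge P)
  hasEdge? P? = any? λ b → any? λ c → P? b ×-dec P? c ×-dec (b ~? c)

  Attached : Subset n → Fin n → Set
  Attached U v = v ∉ U × ∃[ u ] (u ∈ U × u ~ v)

  attached? : ∀ U → Decidable (Attached U)
  attached? U v = ¬? (v ∈? U) ×-dec any? λ u → (u ∈? U) ×-dec (u ~? v)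

  -- Connectedness of `U`, phrased by walks from a root so that it survives adding one attached
  -- vertex at a time.
  Rooted : Fin n → Subset n → Set
  Rooted r U = r ∈ U × (∀ {u} → u ∈ U → Star (Within (_∈ U)) r u)

  Rooted-⁅⁆ : ∀ r → Rooted r ⁅ r ⁆
  Rooted-⁅⁆ r = x∈⁅x⁆ r , λ u∈ → subst (Star _ r) (≡-sym (x∈⁅y⁆⇒x≡y r u∈)) ε

  Rooted-∪ : ∀ {r U v} → Rooted r U → Attached U v → Rooted r (⁅ v ⁆ ∪ U)
  Rooted-∪ {r} {U} {v} (r∈U , walks) (_ , u , u∈U , u~v) =
    q⊆p∪q _ _ r∈U , walks′ ∘ x∈p∪q⁻ _ _
    where
    walk-old : ∀ {w} → w ∈ U → Star (Within (_∈ (⁅ v ⁆ ∪ U))) r w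
    walk-old = Star.map (λ { (e , x , y) → e , q⊆p∪q _ _ x , q⊆p∪q _ _ y }) ∘ walks

    walks′ : ∀ {w} → w ∈ ⁅ v ⁆ ⊎ w ∈ U → Star (Within (_∈ (⁅ v ⁆ ∪ U))) r w
    walks′ (inj₂ w∈U) = walk-old w∈U
    walks′ (inj₁ w∈v) rewrite x∈⁅y⁆⇒x≡y v w∈v =
      walk-old u∈U ◅◅ (u~v , q⊆p∪q _ _ u∈U , x∈p∪q⁺ (inj₁ (x∈⁅x⁆ v))) ◅ ε

  -- Maximality of `U` among the connected sets that leave an edge, tested on enlargements by one
  -- vertex.
  Saturated : Subset n → Subset n → Set
  Saturated S U = ∀ {v} → Attached U v → ¬ HasEdge (Free S (⁅ v ⁆ ∪ U))

  -- Each added vertex strictly enlarges `U` inside a finite vertex set, so the enlargement stops.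
  saturate : ∀ S {r U} → Acc _⊃_ U → Rooted r U → HasEdge (Free S U) →
    ∃[ U′ ] (Rooted r U′ × HasEdge (Free S U′) × Saturated S U′)
  saturate S {r} {U} (acc rec) rooted edge
    with any? (λ v → attached? U v ×-dec hasEdge? (free? S (⁅ v ⁆ ∪ U)))
  ... | yes (v , att@(v∉U , _) , edge′) =
    saturate S (rec (q⊆p∪q _ _ , v , x∈p∪q⁺ (inj₁ (x∈⁅x⁆ v)) , v∉U)) (Rooted-∪ rooted att) edge′
  ... | no ¬larger = U , rooted , edge , λ att edge′ → ¬larger (_ , att , edge′)

  -- The removed set N[U] is harmless: two flanks outside S ∖ N[U] are linked through U, and a
  -- single one would, by saturation, be adjacent to an end of the opposite outer edge.
  avoidableIn-extend : ∀ S {r U b c} → Rooted r U → Saturated S U → Free S U b → Free S U c →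
    AvoidableIn (subsetOf (free? S U)) b c → AvoidableIn S b c
  avoidableIn-extend S {r} {U} {b} {c} (_ , walks) sat
    fb@(b∈S , b∉U , U≁b) fc@(c∈S , c∉U , U≁c) avoid {a} {d} a∈S d∈S
    fl@(flanks a~b c~d a≢c b≢d a≁c b≁d a≁d) = go (free? S U a) (free? S U d)
    where
    attach : ∀ {v} → v ∈ S → v ∉ U → ¬ Free S U v → Attached U v
    attach {v} v∈S v∉U ¬free = decidable-stable (attached? U v)
      λ ¬att → ¬free (v∈S , v∉U , λ u u∈U u~v → ¬att (v∉U , u , u∈U , u~v))

    free-∪ : ∀ {v w} → Free S U w → w ≢ v → ¬ v ~ w → Free S (⁅ v ⁆ ∪ U) w
    free-∪ {v} {w} (w∈S , w∉U , U≁w) w≢v v≁w =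
      w∈S ,
      Sum.[ w≢v ∘ x∈⁅y⁆⇒x≡y v , w∉U ] ∘ x∈p∪q⁻ _ _ ,
      λ u u∈ u~w → Sum.[ (λ u∈v → v≁w (subst (_~ w) (x∈⁅y⁆⇒x≡y v u∈v) u~w)) , (λ u∈U → U≁w u u∈U u~w) ]
        (x∈p∪q⁻ _ _ u∈)

    a∉U : a ∉ U
    a∉U a∈U = U≁b a a∈U a~b

    d∉U : d ∉ U
    d∉U d∈U = U≁c d d∈U (~-sym c~d)

    U-clear : ∀ {u} → u ∈ U → Clear b c a d u
    U-clear u∈U = clear
      (λ { refl → b∉U u∈U }) (λ { refl → c∉U u∈U })
      (λ b~u → ⊥-elim (U≁b _ u∈U (~-sym b~u))) (λ c~u → ⊥-elim (U≁c _ u∈U (~-sym c~u)))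

    through-U : ∀ {u v} → u ∈ U → v ∈ U → Star (Within (Clear b c a d)) u v
    through-U u∈U v∈U =
      Star.map (λ { (e , x , y) → e , U-clear x , U-clear y })
        (Star.reverse Within-sym (walks u∈U) ◅◅ walks v∈U)

    go : Dec (Free S U a) → Dec (Free S U d) → Star (Within (Clear b c a d)) a d
    go (yes fa) (yes fd) = avoid (∈-subsetOf⁺ (free? S U) fa) (∈-subsetOf⁺ (free? S U) fd) fl
    go (yes fa) (no ¬fd) = ⊥-elim (sat (attach d∈S d∉U ¬fd)
      (a , b , free-∪ fa (λ { refl → a≁c (~-sym c~d) }) (a≁d ∘ ~-sym) , free-∪ fb b≢d (b≁d ∘ ~-sym) , a~b))
    go (no ¬fa) (yes fd) = ⊥-elim (sat (attach a∈S a∉U ¬fa)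
      (c , d , free-∪ fc (a≢c ∘ ≡-sym) a≁c , free-∪ fd (λ { refl → a≁c (~-sym c~d) }) a≁d , c~d))
    go (no ¬fa) (no ¬fd) with attach a∈S a∉U ¬fa | attach d∈S d∉U ¬fd
    ... | _ , u , u∈U , u~a | _ , v , v∈U , v~d =
      (~-sym u~a , flank-clear fl , U-clear u∈U) ◅ through-U u∈U v∈U ◅◅
      (v~d , U-clear v∈U , Clear-sym (flank-clear (Flanks-sym fl))) ◅ ε

  avoidableIn-exists : ∀ S → Acc _⊂_ S → HasEdge (_∈ S) →
    ∃[ b ] ∃[ c ] (b ∈ S × c ∈ S × b ~ c × AvoidableIn S b c)
  avoidableIn-exists S (acc rec) (b₀ , c₀ , b₀∈S , c₀∈S , b₀~c₀)
    with any? (λ r → (r ∈? S) ×-dec hasEdge? (free? S ⁅ r ⁆))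
  -- If no N[r] with `r` in `S` leaves an edge, avoidability is vacuous: for flanks `a` and `d` the
  -- edge c d would survive outside N[a].
  ... | no ¬edge = b₀ , c₀ , b₀∈S , c₀∈S , b₀~c₀ , λ {a} {d} a∈S d∈S fl → ⊥-elim (outer-edge a∈S d∈S fl)
    where
    free-from : ∀ {a w} → w ∈ S → w ≢ a → ¬ a ~ w → Free S ⁅ a ⁆ w
    free-from {a} {w} w∈S w≢a a≁w = w∈S , w≢a ∘ x∈⁅y⁆⇒x≡y a ,
      λ u u∈a u~w → a≁w (subst (_~ w) (x∈⁅y⁆⇒x≡y a u∈a) u~w)

    outer-edge : ∀ {a d} → a ∈ S → d ∈ S → ¬ Flanks b₀ c₀ a d
    outer-edge {a} {d} a∈S d∈S (flanks a~b c~d a≢c b≢d a≁c b≁d a≁d) = ¬edge (a , a∈S , c₀ , d ,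
      free-from c₀∈S (a≢c ∘ ≡-sym) a≁c , free-from d∈S (λ { refl → a≁c (~-sym c~d) }) a≁d , c~d)
  ... | yes (r , r∈S , edge)
    with saturate S (⊃-wellFounded ⁅ r ⁆) (Rooted-⁅⁆ r) edge
  ... | U , rooted , (b₁ , c₁ , fb₁ , fc₁ , b₁~c₁) , sat
    -- The root `r` lies in `S` and in `U`, hence is not free, and the new set is strictly smaller.
    with avoidableIn-exists (subsetOf (free? S U))
           (rec (proj₁ ∘ ∈-subsetOf⁻ (free? S U) ,
                 r , r∈S , λ r∈ → proj₁ (proj₂ (∈-subsetOf⁻ (free? S U) r∈)) (proj₁ rooted)))
           (b₁ , c₁ , ∈-subsetOf⁺ (free? S U) fb₁ , ∈-subsetOf⁺ (free? S U) fc₁ , b₁~c₁)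
  ... | b , c , b∈ , c∈ , b~c , avoid
    with ∈-subsetOf⁻ (free? S U) b∈ | ∈-subsetOf⁻ (free? S U) c∈
  ... | fb | fc = b , c , proj₁ fb , proj₁ fc , b~c , avoidableIn-extend S rooted sat fb fc avoid

  -- Flanks of the image edge are pulled back along `σ`, and the walk found between them is pushed
  -- forward again.
  avoidable-transport : ∀ σ → IsAutomorphism G σ → ∀ {b c} → Avoidable b c →
    Avoidable (σ ⟨$⟩ʳ b) (σ ⟨$⟩ʳ c)
  avoidable-transport σ aut {b} {c} avoid {a} {d} (flanks a~b c~d a≢c b≢d a≁c b≁d a≁d) =
    align-ends (Star.gmap (σ ⟨$⟩ʳ_) (λ { (e , P , Q) → automorphism-~ σ aut e , image-clear P , image-clear Q })
      (avoid (flanks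
        (~-sym (automorphism-~⁻ σ aut (~-sym a~b)))
        (automorphism-~⁻ σ aut c~d)
        (λ eq → a≢c (trans (≡-sym σσ⁻¹) (cong (σ ⟨$⟩ʳ_) eq)))
        (λ eq → b≢d (trans (cong (σ ⟨$⟩ʳ_) eq) σσ⁻¹))
        (λ e → a≁c (subst (_~ _) σσ⁻¹ (automorphism-~ σ aut e)))
        (λ e → b≁d (subst (_ ~_) σσ⁻¹ (automorphism-~ σ aut e)))
        (λ e → a≁d (subst (_~ d) σσ⁻¹ (subst (_ ~_) σσ⁻¹ (automorphism-~ σ aut e)))))))
    where
    σσ⁻¹ : ∀ {v} → σ ⟨$⟩ʳ (σ ⟨$⟩ˡ v) ≡ v
    σσ⁻¹ = Perm.inverseʳ σ

    σ⁻¹σ : ∀ {v} → σ ⟨$⟩ˡ (σ ⟨$⟩ʳ v) ≡ v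
    σ⁻¹σ = Perm.inverseˡ σ

    R = Within (Clear (σ ⟨$⟩ʳ b) (σ ⟨$⟩ʳ c) a d)

    align-ends : Star R (σ ⟨$⟩ʳ (σ ⟨$⟩ˡ a)) (σ ⟨$⟩ʳ (σ ⟨$⟩ˡ d)) → Star R a d
    align-ends walk rewrite σσ⁻¹ {a} | σσ⁻¹ {d} = walk

    σ-injective : ∀ {u v} → σ ⟨$⟩ʳ u ≡ σ ⟨$⟩ʳ v → u ≡ v
    σ-injective eq = trans (≡-sym σ⁻¹σ) (trans (cong (σ ⟨$⟩ˡ_) eq) σ⁻¹σ)

    image-clear : ∀ {v} → Clear b c (σ ⟨$⟩ˡ a) (σ ⟨$⟩ˡ d) v → Clear (σ ⟨$⟩ʳ b) (σ ⟨$⟩ʳ c) a d (σ ⟨$⟩ʳ v)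
    image-clear (clear v≢b v≢c b~v c~v) = clear
      (v≢b ∘ σ-injective) (v≢c ∘ σ-injective)
      (λ e → trans (cong (σ ⟨$⟩ʳ_) (b~v (trans (≡-sym (aut _ _)) e))) σσ⁻¹)
      (λ e → trans (cong (σ ⟨$⟩ʳ_) (c~v (trans (≡-sym (aut _ _)) e))) σσ⁻¹)

  edgeTransitive⇒avoidable : EdgeTransitive G → ∀ {b c} → b ~ c → Avoidable b c
  edgeTransitive⇒avoidable et {b} {c} b~c
    with avoidableIn-exists ⊤ (⊂-wellFounded ⊤) (b , c , ∈⊤ , ∈⊤ , b~c)
  ... | b₀ , c₀ , _ , _ , b₀~c₀ , avoid
    with et b₀ c₀ b c b₀~c₀ b~c
  ... | σ , aut , inj₁ (refl , refl) = avoidable-transport σ aut (avoid ∈⊤ ∈⊤)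
  -- The automorphism may reverse the edge.
  ... | σ , aut , inj₂ (refl , refl) = Avoidable-sym (avoidable-transport σ aut (avoid ∈⊤ ∈⊤))

  -- The induced path `q` from `a` to `d` runs through clear vertices, so `b` sees only its first
  -- vertex and `c` only its last. Hence `b` prolongs it to an induced path, and `c` closes that
  -- path.
  flanked-onCycle : ∀ {a b c d} → b ~ c → Flanks b c a d → Avoidable b c →
    OnInducedCycle (a ∷ b ∷ c ∷ d ∷ [])
  flanked-onCycle {a} {b} {c} {d} b~c fl@(flanks a~b c~d a≢c b≢d a≁c b≁d a≁d) avoid
    with shortcut (flank-clear fl) (avoid fl)
  ... | m , q , ind@((inj , _) , _) , refl , refl , cl =
    _ , c ∷ᵥ b ∷ᵥ q , close-inducedPath bq-induced c∉bq (~-sym b~c) c~d ends ,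
    -- The cycle is listed as c, b, a, ..., d.
    (2F , refl) ∷ (1F , refl) ∷ (0F , refl) ∷ (suc (suc (fromℕ m)) , refl) ∷ []
    where
    bq-induced : IsInducedPath G (suc m) (b ∷ᵥ q)
    bq-induced = cons-induced ind (λ i → Clear.v≢b (cl i) ∘ ≡-sym) (~-sym a~b)
      λ i b~q → case inj (Clear.b~v⇒v≡a (cl (suc i)) b~q) of λ ()

    c∉bq : ∀ i → c ≢ (b ∷ᵥ q) i
    c∉bq zero    = ~⇒≢ b~c ∘ ≡-sym
    c∉bq (suc i) = Clear.v≢c (cl i) ∘ ≡-sym

    ends : ∀ i → c ~ (b ∷ᵥ q) i → i ≡ zero ⊎ i ≡ suc (fromℕ m)
    ends zero    _   = inj₁ refl
    ends (suc i) c~q = inj₂ (cong suc (inj (Clear.c~v⇒v≡d (cl i) c~q)))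

  -- Short paths

  triangle-onCycle : ∀ {a b c} → a ~ b → b ~ c → a ~ c → OnInducedCycle (a ∷ b ∷ c ∷ [])
  triangle-onCycle {a} {b} {c} a~b b~c a~c =
    _ , c ∷ᵥ a ∷ᵥ b ∷ᵥ VF.[] ,
    close-inducedPath
      (cons-induced (singleton-induced b) (λ { 0F → ~⇒≢ a~b }) a~b λ ())
      (λ { 0F → ~⇒≢ (~-sym a~c) ; 1F → ~⇒≢ (~-sym b~c) })
      (~-sym a~c) (~-sym b~c) (λ { 0F _ → inj₁ refl ; 1F _ → inj₂ refl }) ,
    (1F , refl) ∷ (2F , refl) ∷ (0F , refl) ∷ []

  square-onCycle : ∀ {a b c d} → a ~ b → b ~ c → c ~ d → d ~ a → a ≢ c → b ≢ d → ¬ a ~ c → ¬ b ~ d →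
    OnInducedCycle (a ∷ b ∷ c ∷ d ∷ [])
  square-onCycle {a} {b} {c} {d} a~b b~c c~d d~a a≢c b≢d a≁c b≁d =
    _ , d ∷ᵥ a ∷ᵥ b ∷ᵥ c ∷ᵥ VF.[] ,
    close-inducedPath
      (cons-induced
        (cons-induced (singleton-induced c) (λ { 0F → ~⇒≢ b~c }) b~c λ ())
        (λ { 0F → ~⇒≢ a~b ; 1F → a≢c }) a~b λ { 0F → a≁c })
      (λ { 0F → ~⇒≢ d~a ; 1F → b≢d ∘ ≡-sym ; 2F → ~⇒≢ (~-sym c~d) })
      d~a (~-sym c~d)
      (λ { 0F _ → inj₁ refl ; 1F d~b → ⊥-elim (b≁d (~-sym d~b)) ; 2F _ → inj₂ refl }) ,
    (1F , refl) ∷ (2F , refl) ∷ (3F , refl) ∷ (0F , refl) ∷ []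

  -- A walk from `b` never leaves N[b], since each neighbour of `b` leads only back to `b`; by
  -- connectedness N[b] is everything.
  star-from-leaves : Connected G → ∀ b → (∀ {w z} → b ~ w → w ~ z → z ≡ b) → IsStar G
  star-from-leaves conn b leaves = b , λ u v → mk⇔ (to u v) from
    where
    reach : ∀ {u v} → Walk G u v → u ≡ b ⊎ b ~ u → v ≡ b ⊎ b ~ v
    reach here            near        = near
    reach (step b~w walk) (inj₁ refl) = reach walk (inj₂ b~w)
    reach (step u~w walk) (inj₂ b~u)  = reach walk (inj₁ (leaves b~u u~w))

    near : ∀ v → v ≡ b ⊎ b ~ v
    near v = reach (conn b v) (inj₁ refl)

    to : ∀ u v → u ~ v → (u ≡ b × v ≢ b) ⊎ (v ≡ b × u ≢ b)
    to u v u~v with near u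
    ... | inj₁ refl = inj₁ (refl , ~⇒≢ u~v ∘ ≡-sym)
    ... | inj₂ b~u  = inj₂ (leaves b~u u~v , ~⇒≢ b~u ∘ ≡-sym)

    from : ∀ {u v} → (u ≡ b × v ≢ b) ⊎ (v ≡ b × u ≢ b) → u ~ v
    from {u} {v} (inj₁ (refl , v≢b)) with near v
    ... | inj₁ v≡b = ⊥-elim (v≢b v≡b)
    ... | inj₂ b~v = b~v
    from {u} {v} (inj₂ (refl , u≢b)) with near u
    ... | inj₁ u≡b = ⊥-elim (u≢b u≡b)
    ... | inj₂ b~u = ~-sym b~u

  -- Inclusion of closed neighbourhoods

  N[_] : Fin n → Fin n → Set
  N[ x ] w = w ≡ x ⊎ x ~ w

  _⊏_ : Fin n → Fin n → Set
  x ⊏ y = (∀ {w} → N[ x ] w → N[ y ] w) × ∃[ w ] (N[ y ] w × ¬ N[ x ] w)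

  ⊏-trans : ∀ {x y z} → x ⊏ y → y ⊏ z → x ⊏ z
  ⊏-trans (x⊆y , _) (y⊆z , w , w∈z , w∉y) = y⊆z ∘ x⊆y , w , w∈z , w∉y ∘ x⊆y

  ⊏-irrefl : ∀ {x} → ¬ x ⊏ x
  ⊏-irrefl (_ , _ , w∈x , w∉x) = w∉x w∈x

  ⊏-isStrictPartialOrder : IsStrictPartialOrder _≡_ _⊏_
  ⊏-isStrictPartialOrder = record
    { isEquivalence = isEquivalence
    ; irrefl        = λ { refl → ⊏-irrefl }
    ; trans         = ⊏-trans
    ; <-resp-≈      = resp₂ _⊏_
    }

  automorphism-⊏ : ∀ σ → IsAutomorphism G σ → ∀ {x y} → x ⊏ y → (σ ⟨$⟩ʳ x) ⊏ (σ ⟨$⟩ʳ y)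
  automorphism-⊏ σ aut {x} {y} (x⊆y , w , w∈y , w∉x) =
    image ∘ x⊆y ∘ preimage , σ ⟨$⟩ʳ w , image′ w∈y , w∉x ∘ preimage′
    where
    image′ : ∀ {x w} → N[ x ] w → N[ σ ⟨$⟩ʳ x ] (σ ⟨$⟩ʳ w)
    image′ = Sum.map (cong (σ ⟨$⟩ʳ_)) (automorphism-~ σ aut)

    preimage : ∀ {x w} → N[ σ ⟨$⟩ʳ x ] w → N[ x ] (σ ⟨$⟩ˡ w)
    preimage = Sum.map (λ { refl → Perm.inverseˡ σ }) (automorphism-~⁻ σ aut)

    image : ∀ {x w} → N[ x ] (σ ⟨$⟩ˡ w) → N[ σ ⟨$⟩ʳ x ] w
    image = subst N[ _ ] (Perm.inverseʳ σ) ∘ image′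

    preimage′ : ∀ {x w} → N[ σ ⟨$⟩ʳ x ] (σ ⟨$⟩ʳ w) → N[ x ] w
    preimage′ = subst N[ _ ] (Perm.inverseˡ σ) ∘ preimage

  -- An edge x ⊏ y is mapped, necessarily without reversal, to any other edge p ⊏ q, so the edge
  -- y ⊏ z above it produces an edge above p ⊏ q: an infinite ascending chain.
  ⊏-noChain : EdgeTransitive G → ∀ {x y z} → x ~ y → y ~ z → x ⊏ y → ¬ y ⊏ z
  ⊏-noChain et {x} {y} {z} x~y y~z x⊏y y⊏z = ascend (spo-noetherian ⊏-isStrictPartialOrder y) x~y x⊏y
    where
    ascend : ∀ {p q} → Acc (λ v u → u ⊏ v) q → p ~ q → ¬ p ⊏ q
    ascend {p} {q} (acc rec) p~q p⊏q with et x y p q x~y p~q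
    ... | σ , aut , inj₁ (refl , refl) =
      ascend (rec (automorphism-⊏ σ aut y⊏z)) (automorphism-~ σ aut y~z) (automorphism-⊏ σ aut y⊏z)
    ... | σ , aut , inj₂ (refl , refl) = ⊏-irrefl (⊏-trans p⊏q (automorphism-⊏ σ aut x⊏y))

  dominated⇒star : Connected G → EdgeTransitive G → ∀ {a b c} → a ~ b → b ~ c → a ≢ c → ¬ a ~ c →
    (∀ {y} → c ~ y → y ≡ b ⊎ b ~ y) → IsStar G
  dominated⇒star conn et {a} {b} {c} a~b b~c a≢c a≁c dom = star-from-leaves conn b leaves
    where
    c⊏b : c ⊏ b
    c⊏b = (λ { (inj₁ refl) → inj₂ b~c ; (inj₂ c~w) → dom c~w }) ,
          a , inj₂ (~-sym a~b) , λ { (inj₁ a≡c) → a≢c a≡c ; (inj₂ c~a) → a≁c (~-sym c~a) }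

    comparable : ∀ {u v} → u ~ v → u ⊏ v ⊎ v ⊏ u
    comparable u~v with et c b _ _ (~-sym b~c) u~v
    ... | σ , aut , inj₁ (refl , refl) = inj₁ (automorphism-⊏ σ aut c⊏b)
    ... | σ , aut , inj₂ (refl , refl) = inj₂ (automorphism-⊏ σ aut c⊏b)

    -- The vertices of a triangle would be pairwise comparable and so form a chain of three, which
    -- `⊏-noChain` forbids.
    noTriangle : ∀ {z} → c ~ z → ¬ b ~ z
    noTriangle c~z b~z with comparable b~z | comparable c~z
    ... | inj₁ b⊏z | _        = ⊏-noChain et (~-sym b~c) b~z c⊏b b⊏z
    ... | inj₂ z⊏b | inj₁ c⊏z = ⊏-noChain et c~z (~-sym b~z) c⊏z z⊏b
    ... | inj₂ z⊏b | inj₂ z⊏c = ⊏-noChain et (~-sym c~z) (~-sym b~c) z⊏c c⊏b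

    c-leaf : ∀ {z} → c ~ z → z ≡ b
    c-leaf c~z with dom c~z
    ... | inj₁ z≡b = z≡b
    ... | inj₂ b~z = ⊥-elim (noTriangle c~z b~z)

    image-leaf : ∀ σ → IsAutomorphism G σ → ∀ {z} → (σ ⟨$⟩ʳ c) ~ z → z ≡ σ ⟨$⟩ʳ b
    image-leaf σ aut e =
      trans (≡-sym (Perm.inverseʳ σ)) (cong (σ ⟨$⟩ʳ_) (c-leaf (automorphism-~⁻ σ aut e)))

    -- Map the edge c b onto w b. If `c` goes to `w`, then `w` is a leaf like `c`; if `c` goes to
    -- `b`, then `b` would be a leaf, although it has the two neighbours `a` and `c`.
    leaves : ∀ {w z} → b ~ w → w ~ z → z ≡ b
    leaves {w} b~w w~z with et c b w b (~-sym b~c) (~-sym b~w)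
    ... | σ , aut , inj₁ (refl , σb≡b) = trans (image-leaf σ aut w~z) σb≡b
    ... | σ , aut , inj₂ (σc≡b , σb≡w) = ⊥-elim (a≢c (trans (only (~-sym a~b)) (≡-sym (only b~c))))
      where
      only : ∀ {z} → b ~ z → z ≡ w
      only b~z = trans (image-leaf σ aut (subst (_~ _) (≡-sym σc≡b) b~z)) σb≡w

  -- Closing paths of length at most three

  module _ (conn : Connected G) (et : EdgeTransitive G) (¬star : ¬ IsStar G) where

    P₄-onCycle : ∀ {a b c d} → b ~ c → Flanks b c a d → OnInducedCycle (a ∷ b ∷ c ∷ d ∷ [])
    P₄-onCycle b~c fl = flanked-onCycle b~c fl (edgeTransitive⇒avoidable et b~c)

    -- A neighbour `y` of `c` outside N[b] gives a 4-cycle if it is adjacent to `a`, and an induced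
    -- path a b c y otherwise. Without such a `y` the vertex `b` dominates `c`.
    P₃-onCycle : ∀ {a b c} → a ~ b → b ~ c → a ≢ c → ¬ a ~ c → OnInducedCycle (a ∷ b ∷ c ∷ [])
    P₃-onCycle {a} {b} {c} a~b b~c a≢c a≁c
      with any? (λ y → (c ~? y) ×-dec ¬? (y ≟ b) ×-dec ¬? (b ~? y))
    ... | no ¬y = ⊥-elim (¬star (dominated⇒star conn et a~b b~c a≢c a≁c λ {y} c~y →
      decidable-stable ((y ≟ b) ⊎-dec (b ~? y)) λ ¬dom → ¬y (y , c~y , ¬dom ∘ inj₁ , ¬dom ∘ inj₂)))
    ... | yes (y , c~y , y≢b , b≁y) with y ~? a
    ...   | yes y~a = forget (square-onCycle a~b b~c c~y y~a a≢c (y≢b ∘ ≡-sym) a≁c b≁y)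
      where
      forget : ∀ {a b c d} → OnInducedCycle (a ∷ b ∷ c ∷ d ∷ []) → OnInducedCycle (a ∷ b ∷ c ∷ [])
      forget (k , cyc , ind , x ∷ y ∷ z ∷ _) = k , cyc , ind , x ∷ y ∷ z ∷ []
    ...   | no y≁a with P₄-onCycle b~c (flanks a~b c~y a≢c (y≢b ∘ ≡-sym) a≁c b≁y (y≁a ∘ ~-sym))
    ...     | k , cyc , ind , x ∷ y ∷ z ∷ _ = k , cyc , ind , x ∷ y ∷ z ∷ []

    extended-onCycle : ∀ {a b y} → a ~ b → b ~ y → y ≢ a → OnInducedCycle (a ∷ b ∷ [])
    extended-onCycle {a} {b} {y} a~b b~y y≢a with a ~? y
    ... | yes a~y with triangle-onCycle a~b b~y a~y
    ...   | k , cyc , ind , x ∷ y ∷ _ = k , cyc , ind , x ∷ y ∷ []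
    extended-onCycle {a} {b} {y} a~b b~y y≢a | no a≁y with P₃-onCycle a~b b~y (y≢a ∘ ≡-sym) a≁y
    ...   | k , cyc , ind , x ∷ y ∷ _ = k , cyc , ind , x ∷ y ∷ []

    P₂-onCycle : ∀ {a b} → a ~ b → OnInducedCycle (a ∷ b ∷ [])
    P₂-onCycle {a} {b} a~b with any? (λ y → (b ~? y) ×-dec ¬? (y ≟ a))
    ... | yes (y , b~y , y≢a) = extended-onCycle a~b b~y y≢a
    ... | no ¬beyond-b with any? (λ y → (a ~? y) ×-dec ¬? (y ≟ b))
    ...   | yes (y , a~y , y≢b) with extended-onCycle (~-sym a~b) a~y y≢b
    ...     | k , cyc , ind , x ∷ y ∷ [] = k , cyc , ind , y ∷ x ∷ []
    -- Neither end has a further neighbour, so by connectedness the graph is the single edge a b, a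
    -- star.
    P₂-onCycle {a} {b} a~b | no ¬beyond-b | no ¬beyond-a = ⊥-elim (¬star (star-from-leaves conn a leaves))
      where
      leaves : ∀ {w z} → a ~ w → w ~ z → z ≡ a
      leaves {w} {z} a~w w~z with w ≟ b | z ≟ a
      ... | _        | yes z≡a = z≡a
      ... | yes refl | no z≢a  = ⊥-elim (¬beyond-b (z , w~z , z≢a))
      ... | no w≢b   | no _    = ⊥-elim (¬beyond-a (w , a~w , w≢b))

    P₁-onCycle : ∀ v → OnInducedCycle (v ∷ [])
    P₁-onCycle v with any? (v ~?_)
    -- A connected graph with an isolated vertex is the one-vertex star.
    ... | no isolated = ⊥-elim (¬star (star-from-leaves conn v λ v~w _ → ⊥-elim (isolated (_ , v~w))))
    ... | yes (w , v~w) with P₂-onCycle v~w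
    ...   | k , cyc , ind , x ∷ _ = k , cyc , ind , x ∷ []

    short-inducedPath-closes : ∀ ℓ → ℓ ≤ 3 → ∀ p → IsInducedPath G ℓ p → ClosesToInducedCycle G ℓ p
    short-inducedPath-closes 0 _ p ind =
      inducedPath-closes ind (P₁-onCycle (p 0F)) λ { (x ∷ []) 0F → x }
    short-inducedPath-closes 1 _ p ind@((_ , edges) , _) =
      inducedPath-closes ind (P₂-onCycle (edges 0F 1F (inj₁ refl)))
        λ { (x ∷ y ∷ []) 0F → x ; (x ∷ y ∷ []) 1F → y }
    short-inducedPath-closes 2 _ p ind@((inj , edges) , chordless) =
      inducedPath-closes ind
        (P₃-onCycle (edges 0F 1F (inj₁ refl)) (edges 1F 2F (inj₁ refl))
          (λ eq → case inj eq of λ ())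
          (λ e → case chordless 0F 2F e of λ { (inj₁ ()) ; (inj₂ ()) }))
        λ { (x ∷ y ∷ z ∷ []) 0F → x ; (x ∷ y ∷ z ∷ []) 1F → y ; (x ∷ y ∷ z ∷ []) 2F → z }
    short-inducedPath-closes 3 _ p ind@((inj , edges) , chordless) =
      inducedPath-closes ind
        (P₄-onCycle (edges 1F 2F (inj₁ refl)) (flanks
          (edges 0F 1F (inj₁ refl)) (edges 2F 3F (inj₁ refl))
          (λ eq → case inj eq of λ ())
          (λ eq → case inj eq of λ ())
          (λ e → case chordless 0F 2F e of λ { (inj₁ ()) ; (inj₂ ()) })
          (λ e → case chordless 1F 3F e of λ { (inj₁ ()) ; (inj₂ ()) })
          (λ e → case chordless 0F 3F e of λ { (inj₁ ()) ; (inj₂ ()) })))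
        λ { (x ∷ y ∷ z ∷ w ∷ []) 0F → x ; (x ∷ y ∷ z ∷ w ∷ []) 1F → y
          ; (x ∷ y ∷ z ∷ w ∷ []) 2F → z ; (x ∷ y ∷ z ∷ w ∷ []) 3F → w }
    short-inducedPath-closes (suc (suc (suc (suc _)))) (s≤s (s≤s (s≤s ())))

2+m≢m : ∀ {m} → suc (suc m) ≢ m
2+m≢m eq = ℕ.<-irrefl (≡-sym eq) (ℕ.m<n⇒m<1+n (ℕ.n<1+n _))

-- Indices of a cycle

module _ {k : ℕ} where

  cyc-next : (i : Fin k) → ∃[ j ] CycIdxAdj₁ i j
  cyc-next i with ℕ.m≤n⇒m<n∨m≡n (toℕ<n i)
  ... | inj₁ 1+i<k = fromℕ< 1+i<k , inj₁ (≡-sym (toℕ-fromℕ< 1+i<k))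
  ... | inj₂ 1+i≡k = fromℕ< {0} 0<k , inj₂ (1+i≡k , toℕ-fromℕ< 0<k)
    where
    0<k : 0 < k
    0<k = ℕ.≤-<-trans z≤n (toℕ<n i)

  cyc-prev : (i : Fin k) → ∃[ j ] CycIdxAdj₁ j i
  cyc-prev zero    = fromℕ _ , inj₂ (cong suc (toℕ-fromℕ _) , refl)
  cyc-prev (suc i) = inject₁ i , inj₁ (cong suc (toℕ-inject₁ i))

  cyc-next-unique : ∀ {i x y : Fin k} → CycIdxAdj₁ i x → CycIdxAdj₁ i y → x ≡ y
  cyc-next-unique (inj₁ p) (inj₁ q) = toℕ-injective (trans (≡-sym p) q)
  cyc-next-unique {x = x} (inj₁ p) (inj₂ (q , _)) = ⊥-elim (ℕ.<-irrefl (trans (≡-sym p) q) (toℕ<n x))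
  cyc-next-unique {y = y} (inj₂ (p , _)) (inj₁ q) = ⊥-elim (ℕ.<-irrefl (trans (≡-sym q) p) (toℕ<n y))
  cyc-next-unique (inj₂ (_ , p)) (inj₂ (_ , q)) = toℕ-injective (trans p (≡-sym q))

  cyc-prev-unique : ∀ {i x y : Fin k} → CycIdxAdj₁ x i → CycIdxAdj₁ y i → x ≡ y
  cyc-prev-unique (inj₁ p) (inj₁ q) = toℕ-injective (ℕ.suc-injective (trans p (≡-sym q)))
  cyc-prev-unique (inj₁ p) (inj₂ (_ , q)) = case trans p q of λ ()
  cyc-prev-unique (inj₂ (_ , p)) (inj₁ q) = case trans q p of λ ()
  cyc-prev-unique (inj₂ (p , _)) (inj₂ (q , _)) = toℕ-injective (ℕ.suc-injective (trans p (≡-sym q)))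

  -- Without wrap-around the two indices differ by 2; with wrap-around their equality would force
  -- `k` to be 1 or 2.
  cyc-next≢prev : 3 ≤ k → ∀ {i x y : Fin k} → CycIdxAdj₁ i x → CycIdxAdj₁ y i → x ≢ y
  cyc-next≢prev 3≤k (inj₁ p) (inj₁ q) refl =
    2+m≢m (trans (cong suc p) q)
  cyc-next≢prev 3≤k (inj₁ p) (inj₂ (q , r)) refl =
    case subst (3 ≤_) (trans (≡-sym q) (cong suc (trans (≡-sym p) (cong suc r)))) 3≤k of λ { (s≤s (s≤s ())) }
  cyc-next≢prev 3≤k (inj₂ (p , r)) (inj₁ q) refl =
    case subst (3 ≤_) (trans (≡-sym p) (cong suc (trans (≡-sym q) (cong suc r)))) 3≤k of λ { (s≤s (s≤s ())) }
  cyc-next≢prev 3≤k (inj₂ (p , r)) (inj₂ (q , _)) refl =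
    case subst (3 ≤_) (trans (≡-sym q) (cong suc r)) 3≤k of λ { (s≤s ()) }

  cyc-two-neighbours : ∀ {i x y z : Fin k} → CycIdxAdj i x → CycIdxAdj i y → CycIdxAdj i z →
    x ≢ y → z ≡ x ⊎ z ≡ y
  cyc-two-neighbours (inj₁ x) (inj₁ y) _        x≢y = ⊥-elim (x≢y (cyc-next-unique x y))
  cyc-two-neighbours (inj₂ x) (inj₂ y) _        x≢y = ⊥-elim (x≢y (cyc-prev-unique x y))
  cyc-two-neighbours (inj₁ x) (inj₂ y) (inj₁ z) _   = inj₁ (cyc-next-unique z x)
  cyc-two-neighbours (inj₁ x) (inj₂ y) (inj₂ z) _   = inj₂ (cyc-prev-unique z y)
  cyc-two-neighbours (inj₂ x) (inj₁ y) (inj₁ z) _   = inj₂ (cyc-next-unique z y)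
  cyc-two-neighbours (inj₂ x) (inj₁ y) (inj₂ z) _   = inj₁ (cyc-prev-unique z x)

-- Trapped paths

-- Interiority is witnessed by both neighbouring indices, because the trapping argument compares a
-- cycle vertex with the two path vertices there.
Interior : ∀ {ℓ} → Fin (suc ℓ) → Set
Interior {ℓ} i = ∃[ h ] ∃[ j ] (suc (toℕ {suc ℓ} h) ≡ toℕ i × suc (toℕ i) ≡ toℕ {suc ℓ} j)

-- In an induced cycle through p, the neighbours of p₀ can only be adjacent to an interior vertex
-- pᵢ if they are pᵢ₋₁ or pᵢ₊₁; being adjacent to p₀, both of them would have to be p₁.
trapped⇒¬closes : ∀ {n} (G : Graph n) {ℓ p} → IsInducedPath G ℓ p →
  (∀ w → Adj G (p zero) w → ∃[ i ] (Interior i × Adj G w (p i))) → ¬ ClosesToInducedCycle G ℓ p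
trapped⇒¬closes G {ℓ} {p} ((inj , edges) , chordless) trapped
  (k , c , ((3≤k , c-injective , cedges) , cchordless) , on , _) with on zero
... | j₀ , p₀≡cj₀ with cyc-next j₀ | cyc-prev j₀
... | s , j₀→s | t , t→j₀ = cyc-next≢prev 3≤k j₀→s t→j₀ (neighbours-agree (inj₁ j₀→s) (inj₂ t→j₀))
  where
  first : ∀ {i : Fin (suc ℓ)} → PathIdxAdj zero i → toℕ i ≡ 1
  first (inj₁ eq) = ≡-sym eq

  path-idx : ∀ {i i′ j j′} → p i ≡ c i′ → p j ≡ c j′ → PathIdxAdj i j → CycIdxAdj i′ j′
  path-idx {i} {i′} {j} {j′} eq eq′ i-j = cchordless i′ j′ (subst₂ (Adj G) eq eq′ (edges i j i-j))

  distinct : ∀ {i i′ j j′} → p i ≡ c i′ → p j ≡ c j′ → toℕ i ≢ toℕ j → i′ ≢ j′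
  distinct eq eq′ i≢j refl = i≢j (cong toℕ (inj (trans eq (≡-sym eq′))))

  is-p₁ : ∀ {r} → CycIdxAdj j₀ r → ∃[ i ] (toℕ i ≡ 1 × p i ≡ c r)
  is-p₁ {r} j₀-r with subst (λ v → Adj G v (c r)) (≡-sym p₀≡cj₀) (cedges j₀ r j₀-r)
  ... | p₀~cr with trapped (c r) p₀~cr
  ... | i , (h , j , h→i , i→j) , cr~pi with on h | on i | on j
  ... | h′ , eqh | i′ , eqi | j′ , eqj
    with cyc-two-neighbours (path-idx eqi eqh (inj₂ h→i)) (path-idx eqi eqj (inj₁ i→j))
      (cchordless i′ r (subst (λ v → Adj G v (c r)) eqi (trans (Graph.sym G _ _) cr~pi)))
      (distinct eqh eqj λ h≡j → 2+m≢m (trans (cong suc h→i) (trans i→j (≡-sym h≡j))))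
  ... | inj₁ refl = h , first (chordless zero h (subst (Adj G (p zero)) (≡-sym eqh) p₀~cr)) , eqh
  ... | inj₂ refl = j , first (chordless zero j (subst (Adj G (p zero)) (≡-sym eqj) p₀~cr)) , eqj

  neighbours-agree : ∀ {r r′} → CycIdxAdj j₀ r → CycIdxAdj j₀ r′ → r ≡ r′
  neighbours-agree {r} {r′} x y with is-p₁ x | is-p₁ y
  ... | i , i≡1 , pi≡cr | i′ , i′≡1 , pi′≡cr′ with toℕ-injective (trans i≡1 (≡-sym i′≡1))
  ... | refl = c-injective (trans (≡-sym pi≡cr) pi′≡cr′)

-- Edge-transitivity from a base arc

module _ {n} (G : Graph n) where

  MapsArc : (a b c d : Fin n) → Set
  MapsArc a b c d = Σ (Permutation′ n) λ σ → IsAutomorphism G σ × σ ⟨$⟩ʳ a ≡ c × σ ⟨$⟩ʳ b ≡ d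

  MapsArc-sym : ∀ {a b c d} → MapsArc a b c d → MapsArc c d a b
  MapsArc-sym (σ , aut , refl , refl) =
    flip σ ,
    (λ u v → trans (≡-sym (aut _ _)) (cong₂ (adj G) (Perm.inverseʳ σ) (Perm.inverseʳ σ))) ,
    Perm.inverseˡ σ , Perm.inverseˡ σ

  MapsArc-trans : ∀ {a b c d e f} → MapsArc a b c d → MapsArc c d e f → MapsArc a b e f
  MapsArc-trans (σ , autσ , refl , refl) (τ , autτ , refl , refl) =
    σ ∘ₚ τ , (λ u v → trans (autτ _ _) (autσ _ _)) , refl , refl

  -- Every edge, in one of its two directions, reaches the base arc; one such map followed by the
  -- inverse of another carries any edge to any other.
  edgeTransitive-from : ∀ {a₀ b₀} →
    (∀ {a b} → Adj G a b → MapsArc a b a₀ b₀ ⊎ MapsArc b a a₀ b₀) → EdgeTransitive G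
  edgeTransitive-from to-base a b c d a~b c~d with to-base a~b | to-base c~d
  ... | inj₁ f | inj₁ g = let σ , aut , x , y = MapsArc-trans f (MapsArc-sym g) in σ , aut , inj₁ (x , y)
  ... | inj₁ f | inj₂ g = let σ , aut , x , y = MapsArc-trans f (MapsArc-sym g) in σ , aut , inj₂ (x , y)
  ... | inj₂ f | inj₁ g = let σ , aut , x , y = MapsArc-trans f (MapsArc-sym g) in σ , aut , inj₂ (y , x)
  ... | inj₂ f | inj₂ g = let σ , aut , x , y = MapsArc-trans f (MapsArc-sym g) in σ , aut , inj₁ (y , x)

HasNonclosingPath : ℕ → Set
HasNonclosingPath ℓ = ∃[ n ] Σ (Graph n) λ G → Connected G × EdgeTransitive G ×
  Σ (Fin (suc ℓ) → Fin n) λ p → IsInducedPath G ℓ p × ¬ ClosesToInducedCycle G ℓ p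

-- The Paley graph on 13 vertices

-- The term `13 ∸ toℕ u` represents -u modulo 13, so nothing is truncated.
difference : Fin 13 → Fin 13 → ℕ
difference u v = (toℕ v + (13 ∸ toℕ u)) % 13

-- The nonzero squares modulo 13. Since 12 = -1 is one of them, adjacency is symmetric.
isResidue : ℕ → Bool
isResidue 1  = true
isResidue 3  = true
isResidue 4  = true
isResidue 9  = true
isResidue 10 = true
isResidue 12 = true
isResidue _  = false

paleyAdj : Fin 13 → Fin 13 → Bool
paleyAdj u v = isResidue (difference u v)

paley : Graph 13
paley = record
  { adj    = paleyAdj
  ; sym    = from-yes (all? λ u → all? λ v → paleyAdj u v Bool.≟ paleyAdj v u)
  ; irrefl = from-yes (all? λ v → paleyAdj v v Bool.≟ false)
  }

-- x ↦ a + (b − a) x; the slope is a sixth root of unity, so its inverse is its fifth power.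
affine affine⁻¹ : Fin 13 → Fin 13 → Fin 13 → Fin 13
affine a b x = (toℕ a + difference a b * toℕ x) mod 13
affine⁻¹ a b y = (s * s * s * s * s * difference a y) mod 13
  where s = difference a b

-- An affine map whose slope is a nonzero square multiplies all differences by that square and so
-- preserves adjacency. The finitely many instances are checked by evaluation.
paley-arcs : ∀ a b → paleyAdj a b ≡ true →
  (∀ y → affine a b (affine⁻¹ a b y) ≡ y) × (∀ x → affine⁻¹ a b (affine a b x) ≡ x) ×
  (∀ u v → paleyAdj (affine a b u) (affine a b v) ≡ paleyAdj u v) ×
  affine a b 0F ≡ a × affine a b 1F ≡ b
paley-arcs = from-yes (all? λ a → all? λ b → (paleyAdj a b Bool.≟ true) →-dec
  (all? λ y → affine a b (affine⁻¹ a b y) ≟ y) ×-dec (all? λ x → affine⁻¹ a b (affine a b x) ≟ x) ×-dec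
  (all? λ u → all? λ v → paleyAdj (affine a b u) (affine a b v) Bool.≟ paleyAdj u v) ×-dec
  (affine a b 0F ≟ a) ×-dec (affine a b 1F ≟ b))

paley? : ∀ u v → Dec (Adj paley u v)
paley? u v = paleyAdj u v Bool.≟ true

paley-edgeTransitive : EdgeTransitive paley
paley-edgeTransitive = edgeTransitive-from paley λ {a} {b} a~b →
  let to-from , from-to , aut , 0↦a , 1↦b = paley-arcs a b a~b
  in inj₁ (MapsArc-sym paley (Perm.permutation (affine a b) (affine⁻¹ a b) to-from from-to , aut , 0↦a , 1↦b))

paley-connected : Connected paley
paley-connected u v with diameter₂ u v
  where
  diameter₂ : ∀ u v → ∃[ w ] (Adj paley u w × Adj paley w v)
  diameter₂ = from-yes (all? λ u → all? λ v → any? λ w → (paley? u w) ×-dec (paley? w v))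
... | w , u~w , w~v = step {w = w} u~w (step {w = v} w~v here)

-- Consecutive differences are 1, 1, 4, 1, all squares; the remaining ones are 2, 5, 6 and 7, all
-- non-squares.
paleyPath : Vector (Fin 13) 5
paleyPath = 0F ∷ᵥ 1F ∷ᵥ 2F ∷ᵥ 6F ∷ᵥ 7F ∷ᵥ VF.[]

pathIdxAdj? : ∀ {ℓ} (i j : Fin (suc ℓ)) → Dec (PathIdxAdj i j)
pathIdxAdj? i j = (suc (toℕ i) ℕ.≟ toℕ j) ⊎-dec (suc (toℕ j) ℕ.≟ toℕ i)

paleyPath-induced : IsInducedPath paley 4 paleyPath
paleyPath-induced =
  ((λ {i} {j} → injective i j) ,
   from-yes (all? λ i → all? λ j → pathIdxAdj? i j →-dec (paley? (paleyPath i) (paleyPath j)))) ,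
  from-yes (all? λ i → all? λ j → (paley? (paleyPath i) (paleyPath j)) →-dec pathIdxAdj? i j)
  where
  injective : ∀ i j → paleyPath i ≡ paleyPath j → i ≡ j
  injective = from-yes (all? λ i → all? λ j → (paleyPath i ≟ paleyPath j) →-dec (i ≟ j))

interior? : ∀ {ℓ} (i : Fin (suc ℓ)) → Dec (Interior i)
interior? i = any? λ h → any? λ j → (suc (toℕ h) ℕ.≟ toℕ i) ×-dec (suc (toℕ i) ℕ.≟ toℕ j)

-- Of the neighbours of 0, the vertices 1, 3 and 12 are adjacent to 2, the vertex 4 to 1, and 9 and
-- 10 to 6.
paleyPath-trapped : ∀ w → Adj paley 0F w → ∃[ i ] (Interior i × Adj paley w (paleyPath i))
paleyPath-trapped = from-yes (all? λ w → (paley? 0F w) →-dec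
  any? λ i → interior? i ×-dec (paley? w (paleyPath i)))

nonclosingPath₄ : HasNonclosingPath 4
nonclosingPath₄ = 13 , paley , paley-connected , paley-edgeTransitive , paleyPath , paleyPath-induced ,
  trapped⇒¬closes paley paleyPath-induced paleyPath-trapped

-- Graphs on arbitrary finite types

Finite : Set → Set
Finite A = ∃[ n ] (Fin n ↔ A)

module FiniteGraph {A : Set} {n : ℕ} (e : Fin n ↔ A) (_~_ : A → A → Set) (_~?_ : ∀ x y → Dec (x ~ y))
  (~-symm : ∀ {x y} → x ~ y → y ~ x) (~-irr : ∀ {x} → ¬ x ~ x) where

  open Inverse e using (to; from; strictlyInverseˡ; strictlyInverseʳ)

  graph : Graph n
  graph = record
    { adj    = λ u v → does (to u ~? to v)
    ; sym    = λ u v → does-⇔ (mk⇔ ~-symm ~-symm) (to u ~? to v) (to v ~? to u)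
    ; irrefl = λ v → dec-false (to v ~? to v) ~-irr
    }

  from-Adj : ∀ {u v} → Adj graph u v → to u ~ to v
  from-Adj {u} {v} a with yes u~v ← to u ~? to v = u~v

  to-Adj : ∀ {u v} → to u ~ to v → Adj graph u v
  to-Adj {u} {v} = dec-true (to u ~? to v)

  to-Adj′ : ∀ {x y} → x ~ y → Adj graph (from x) (from y)
  to-Adj′ x~y = to-Adj (subst₂ _~_ (≡-sym (strictlyInverseˡ _)) (≡-sym (strictlyInverseˡ _)) x~y)

  from-Adj′ : ∀ {x y} → Adj graph (from x) (from y) → x ~ y
  from-Adj′ a = subst₂ _~_ (strictlyInverseˡ _) (strictlyInverseˡ _) (from-Adj a)

  connected : (∀ x y → Star _~_ x y) → Connected graph
  connected walks u v =
    subst₂ (Walk graph) (strictlyInverseʳ u) (strictlyInverseʳ v) (walk (walks (to u) (to v)))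
    where
    walk : ∀ {x y} → Star _~_ x y → Walk graph (from x) (from y)
    walk ε           = here
    walk (x~y ◅ y⇝z) = step (to-Adj′ x~y) (walk y⇝z)

  Symmetry : (a b c d : A) → Set
  Symmetry a b c d = Σ (A ↔ A) λ τ → let open Inverse τ renaming (to to τ·) using () in
    (∀ x y → x ~ y ⇔ τ· x ~ τ· y) × τ· a ≡ c × τ· b ≡ d

  Symmetry-trans : ∀ {a b c d e f} → Symmetry a b c d → Symmetry c d e f → Symmetry a b e f
  Symmetry-trans (σ , autσ , refl , refl) (τ , autτ , refl , refl) =
    ↔-trans σ τ ,
    (λ x y → mk⇔ (Equivalence.to (autτ _ _) ∘ Equivalence.to (autσ x y))
                 (Equivalence.from (autσ x y) ∘ Equivalence.from (autτ _ _))) ,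
    refl , refl

  -- The symmetry is conjugated by the numbering `e`.
  symmetry⇒MapsArc : ∀ {u v c d} → Symmetry (to u) (to v) c d → MapsArc graph u v (from c) (from d)
  symmetry⇒MapsArc (τ , aut , refl , refl) =
    ↔-trans e (↔-trans τ (↔-sym e)) ,
    (λ x y → does-⇔
      (mk⇔ (Equivalence.from (aut _ _) ∘ subst₂ _~_ (strictlyInverseˡ _) (strictlyInverseˡ _))
           (subst₂ _~_ (≡-sym (strictlyInverseˡ _)) (≡-sym (strictlyInverseˡ _)) ∘ Equivalence.to (aut _ _)))
      (_ ~? _) (_ ~? _)) ,
    refl , refl

  edgeTransitive : ∀ {a₀ b₀} → (∀ {a b} → a ~ b → Symmetry a b a₀ b₀ ⊎ Symmetry b a a₀ b₀) →
    EdgeTransitive graph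
  edgeTransitive to-base = edgeTransitive-from graph
    (Sum.map symmetry⇒MapsArc symmetry⇒MapsArc ∘ to-base ∘ from-Adj)

  module _ {ℓ} (p : Fin (suc ℓ) → A) where

    inducedPath : (∀ {i j} → p i ≡ p j → i ≡ j) → (∀ {i j} → p i ~ p j ⇔ PathIdxAdj i j) →
      IsInducedPath graph ℓ (from ∘ p)
    inducedPath inj p~p =
      ((λ eq → inj (trans (≡-sym (strictlyInverseˡ _)) (trans (cong to eq) (strictlyInverseˡ _)))) ,
       λ i j → to-Adj′ ∘ Equivalence.from p~p) ,
      λ i j → Equivalence.to p~p ∘ from-Adj′

    trapped : (∀ {x} → p zero ~ x → ∃[ i ] (Interior i × x ~ p i)) →
      ∀ w → Adj graph (from (p zero)) w → ∃[ i ] (Interior i × Adj graph w (from (p i)))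
    trapped trap w a with trap (subst (_~ to w) (strictlyInverseˡ _) (from-Adj a))
    ... | i , int , w~pi = i , int , to-Adj (subst (to w ~_) (≡-sym (strictlyInverseˡ _)) w~pi)

-- Refinements of finite types

-- Proofs in a refinement are irrelevant, so each index satisfying `P` is counted once; the count
-- decides index zero and recurses.
Finite-refinement-Fin : ∀ N {P : Fin N → Set} → (∀ i → Dec (P i)) → Finite (Refinement (Fin N) P)
Finite-refinement-Fin zero    P? = 0 , mk↔ₛ′ (λ ()) (λ { (() ,ᴿ _) }) (λ { (() ,ᴿ _) }) λ ()
Finite-refinement-Fin (suc N) {P} P? with Finite-refinement-Fin N (P? ∘ suc)
... | k , e = extend (P? zero)
  where
  open Inverse e using (to; from; strictlyInverseˡ; strictlyInverseʳ)

  lift : Refinement (Fin N) (P ∘ suc) → Refinement (Fin (suc N)) P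
  lift = Refinement.map suc (λ p → p)

  extend : Dec (P zero) → Finite (Refinement (Fin (suc N)) P)
  extend (yes p₀) = suc k , mk↔ₛ′ into back
    (λ { (zero ,ᴿ _) → refl ; (suc i ,ᴿ p) → cong lift (strictlyInverseˡ (i ,ᴿ p)) })
    (λ { zero → refl ; (suc i) → cong suc (strictlyInverseʳ i) })
    where
    into : Fin (suc k) → Refinement (Fin (suc N)) P
    into zero    = zero ,ᴿ [ p₀ ]
    into (suc i) = lift (to i)

    back : Refinement (Fin (suc N)) P → Fin (suc k)
    back (zero  ,ᴿ _) = zero
    back (suc i ,ᴿ p) = suc (from (i ,ᴿ p))
  extend (no ¬p₀) = k , mk↔ₛ′ (lift ∘ to) back
    (λ { (zero ,ᴿ [ p ]) → ⊥-elim-irr (¬p₀ p) ; (suc i ,ᴿ p) → cong lift (strictlyInverseˡ (i ,ᴿ p)) })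
    strictlyInverseʳ
    where
    back : Refinement (Fin (suc N)) P → Fin k
    back (zero  ,ᴿ [ p ]) = ⊥-elim-irr (¬p₀ p)
    back (suc i ,ᴿ p)     = from (i ,ᴿ p)

Finite-refinement : ∀ {A : Set} {P : A → Set} → Finite A → (∀ x → Dec (P x)) → Finite (Refinement A P)
Finite-refinement {P = P} (N , e) P? with Finite-refinement-Fin N (P? ∘ Inverse.to e)
... | k , f = k , ↔-trans f (mk↔ₛ′
  (Refinement.map to (λ p → p))
  (Refinement.map from (subst P (≡-sym (strictlyInverseˡ _))))
  (λ _ → value-injective (strictlyInverseˡ _))
  (λ _ → value-injective (strictlyInverseʳ _)))
  where open Inverse e using (to; from; strictlyInverseˡ; strictlyInverseʳ)

Finite-Fin : ∀ m → Finite (Fin m)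
Finite-Fin m = m , ↔-refl

Finite-× : ∀ {A B : Set} → Finite A → Finite B → Finite (A × B)
Finite-× (_ , e) (_ , f) = _ , ↔-trans *↔× (e ×-↔ f)

Finite-⊎ : ∀ {A B : Set} → Finite A → Finite B → Finite (A ⊎ B)
Finite-⊎ (_ , e) (_ , f) = _ , ↔-trans +↔⊎ (e ⊎-↔ f)

-- Transpositions

transpose-source : ∀ {n} (i j : Fin n) → transpose i j ⟨$⟩ʳ i ≡ j
transpose-source i j rewrite dec-true (i ≟ i) refl = refl

transpose-fixed : ∀ {n} {i j k : Fin n} → k ≢ i → k ≢ j → transpose i j ⟨$⟩ʳ k ≡ k
transpose-fixed {i = i} {j} {k} k≢i k≢j rewrite dec-false (k ≟ i) k≢i | dec-false (k ≟ j) k≢j = refl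

perm-injective : ∀ {n} (π : Permutation′ n) {i j} → π ⟨$⟩ʳ i ≡ π ⟨$⟩ʳ j → i ≡ j
perm-injective π eq = trans (≡-sym (Perm.inverseˡ π)) (trans (cong (π ⟨$⟩ˡ_) eq) (Perm.inverseˡ π))

Distinct₃ : ∀ {m} → Fin m × Fin m × Fin m → Set
Distinct₃ (a , b , c) = a ≢ b × a ≢ c × b ≢ c

-- Three transpositions put `a`, `b` and `c` in place one after the other. A later one fixes the
-- targets already reached, by distinctness of the targets and of the sources.
perm-3-transitive : ∀ {m} {a b c x y z : Fin m} → Distinct₃ (a , b , c) → Distinct₃ (x , y , z) →
  Σ (Permutation′ m) λ π → π ⟨$⟩ʳ a ≡ x × π ⟨$⟩ʳ b ≡ y × π ⟨$⟩ʳ c ≡ z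
perm-3-transitive {a = a} {b} {c} {x} {y} {z} (a≢b , a≢c , b≢c) (x≢y , x≢z , y≢z) =
  π₁ ∘ₚ π₂ ∘ₚ π₃ ,
  trans (cong (λ i → π₃ ⟨$⟩ʳ (π₂ ⟨$⟩ʳ i)) a↦x)
    (trans (cong (π₃ ⟨$⟩ʳ_) x↦x) (transpose-fixed (λ eq → a≢c (perm-injective π₁ (perm-injective π₂
      (trans (cong (π₂ ⟨$⟩ʳ_) a↦x) (trans x↦x eq))))) x≢z)) ,
  trans (cong (π₃ ⟨$⟩ʳ_) b↦y)
    (transpose-fixed (λ eq → b≢c (perm-injective π₁ (perm-injective π₂ (trans b↦y eq)))) y≢z) ,
  transpose-source (π₂ ⟨$⟩ʳ (π₁ ⟨$⟩ʳ c)) z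
  where
  π₁ = transpose a x
  a↦x : π₁ ⟨$⟩ʳ a ≡ x
  a↦x = transpose-source a x
  π₂ = transpose (π₁ ⟨$⟩ʳ b) y
  b↦y : π₂ ⟨$⟩ʳ (π₁ ⟨$⟩ʳ b) ≡ y
  b↦y = transpose-source (π₁ ⟨$⟩ʳ b) y
  x↦x : π₂ ⟨$⟩ʳ x ≡ x
  x↦x = transpose-fixed (λ eq → a≢b (perm-injective π₁ (trans a↦x eq))) x≢y
  π₃ = transpose (π₂ ⟨$⟩ʳ (π₁ ⟨$⟩ʳ c)) z

distinct₃? : ∀ {m} (t : Fin m × Fin m × Fin m) → Dec (Distinct₃ t)
distinct₃? (a , b , c) = ¬? (a ≟ b) ×-dec ¬? (a ≟ c) ×-dec ¬? (b ≟ c)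

-- The incidence graph of points and ordered triples

module PointsAndTriples (m : ℕ) where

  -- Ordered triples stand in for 3-element sets: each set occurs six times, as nodes with the same
  -- neighbours. The irrelevant proof makes equality a matter of the entries alone.
  Triple : Set
  Triple = Refinement (Fin m × Fin m × Fin m) Distinct₃

  Node : Set
  Node = Fin m ⊎ Triple

  Node-finite : Finite Node
  Node-finite = Finite-⊎ (Finite-Fin m)
    (Finite-refinement (Finite-× (Finite-Fin m) (Finite-× (Finite-Fin m) (Finite-Fin m))) distinct₃?)

  data _∈ᵗ_ (x : Fin m) : Triple → Set where
    fst : ∀ {b c d} → x ∈ᵗ ((x , b , c) ,ᴿ d)
    snd : ∀ {a c d} → x ∈ᵗ ((a , x , c) ,ᴿ d)
    trd : ∀ {a b d} → x ∈ᵗ ((a , b , x) ,ᴿ d)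

  ∈ᵗ⇒ : ∀ {x a b c d} → x ∈ᵗ ((a , b , c) ,ᴿ d) → x ≡ a ⊎ x ≡ b ⊎ x ≡ c
  ∈ᵗ⇒ fst = inj₁ refl
  ∈ᵗ⇒ snd = inj₂ (inj₁ refl)
  ∈ᵗ⇒ trd = inj₂ (inj₂ refl)

  _∈ᵗ?_ : ∀ x T → Dec (x ∈ᵗ T)
  x ∈ᵗ? ((a , b , c) ,ᴿ d) = map′
    (λ { (inj₁ refl) → fst ; (inj₂ (inj₁ refl)) → snd ; (inj₂ (inj₂ refl)) → trd })
    ∈ᵗ⇒
    ((x ≟ a) ⊎-dec (x ≟ b) ⊎-dec (x ≟ c))

  data _~_ : Node → Node → Set where
    point-triple : ∀ {x T} → x ∈ᵗ T → inj₁ x ~ inj₂ T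
    triple-point : ∀ {x T} → x ∈ᵗ T → inj₂ T ~ inj₁ x

  _~?_ : ∀ u v → Dec (u ~ v)
  inj₁ x ~? inj₁ y = no λ ()
  inj₁ x ~? inj₂ T = map′ point-triple (λ { (point-triple x∈T) → x∈T }) (x ∈ᵗ? T)
  inj₂ T ~? inj₁ x = map′ triple-point (λ { (triple-point x∈T) → x∈T }) (x ∈ᵗ? T)
  inj₂ S ~? inj₂ T = no λ ()

  ~-symm : ∀ {u v} → u ~ v → v ~ u
  ~-symm (point-triple x∈T) = triple-point x∈T
  ~-symm (triple-point x∈T) = point-triple x∈T

  ~-irreflexive : ∀ {u} → ¬ u ~ u
  ~-irreflexive {inj₁ _} ()
  ~-irreflexive {inj₂ _} ()

  open FiniteGraph (proj₂ Node-finite) _~_ _~?_ ~-symm ~-irreflexive public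

  permuteTriple : Permutation′ m → Triple → Triple
  permuteTriple π = Refinement.map
    (λ { (a , b , c) → π ⟨$⟩ʳ a , π ⟨$⟩ʳ b , π ⟨$⟩ʳ c })
    (λ { (a≢b , a≢c , b≢c) → a≢b ∘ perm-injective π , a≢c ∘ perm-injective π , b≢c ∘ perm-injective π })

  permute-∈ : ∀ π {x T} → x ∈ᵗ T → (π ⟨$⟩ʳ x) ∈ᵗ permuteTriple π T
  permute-∈ π fst = fst
  permute-∈ π snd = snd
  permute-∈ π trd = trd

  permute : Permutation′ m → Node → Node
  permute π = Sum.map (π ⟨$⟩ʳ_) (permuteTriple π)

  permute-~ : ∀ π {u v} → u ~ v → permute π u ~ permute π v
  permute-~ π (point-triple x∈T) = point-triple (permute-∈ π x∈T)
  permute-~ π (triple-point x∈T) = triple-point (permute-∈ π x∈T)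

  permute-inverse : ∀ π u → permute (flip π) (permute π u) ≡ u
  permute-inverse π (inj₁ x) = cong inj₁ (Perm.inverseˡ π)
  permute-inverse π (inj₂ _) = cong inj₂ (value-injective
    (cong₂ _,_ (Perm.inverseˡ π) (cong₂ _,_ (Perm.inverseˡ π) (Perm.inverseˡ π))))

  permute-symmetry : ∀ π {u v} → Symmetry u v (permute π u) (permute π v)
  permute-symmetry π =
    mk↔ₛ′ (permute π) (permute (flip π)) (permute-inverse (flip π)) (permute-inverse π) ,
    (λ u v → mk⇔ (permute-~ π)
      (subst₂ _~_ (permute-inverse π u) (permute-inverse π v) ∘ permute-~ (flip π))) ,
    refl , refl

  -- Incidence ignores the order of entries, so rotating all triples while fixing all points is an
  -- automorphism. Repeated rotation brings any chosen entry to the front.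
  rotateTriple : Triple → Triple
  rotateTriple = Refinement.map
    (λ { (a , b , c) → b , c , a })
    (λ { (a≢b , a≢c , b≢c) → b≢c , a≢b ∘ ≡-sym , a≢c ∘ ≡-sym })

  rotate : Node → Node
  rotate = Sum.map₂ rotateTriple

  rotate-~ : ∀ {u v} → u ~ v → rotate u ~ rotate v
  rotate-~ (point-triple fst) = point-triple trd
  rotate-~ (point-triple snd) = point-triple fst
  rotate-~ (point-triple trd) = point-triple snd
  rotate-~ (triple-point fst) = triple-point trd
  rotate-~ (triple-point snd) = triple-point fst
  rotate-~ (triple-point trd) = triple-point snd

  rotate³ : ∀ u → rotate (rotate (rotate u)) ≡ u
  rotate³ (inj₁ _) = refl
  rotate³ (inj₂ _) = refl

  rotate-symmetry : ∀ {u v} → Symmetry u v (rotate u) (rotate v)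
  rotate-symmetry =
    mk↔ₛ′ rotate (rotate ∘ rotate) rotate³ rotate³ ,
    (λ u v → mk⇔ rotate-~ (subst₂ _~_ (rotate³ u) (rotate³ v) ∘ rotate-~ ∘ rotate-~)) ,
    refl , refl

  flag-symmetry : ∀ {x T y b c d} → x ∈ᵗ T → Symmetry (inj₁ x) (inj₂ T) (inj₁ y) (inj₂ ((y , b , c) ,ᴿ d))
  flag-symmetry {y = y} {b} {c} {d@([ y≢ ])} = via
    where
    align : ∀ {x p q} (e : Irrelevant (Distinct₃ (x , p , q))) →
      Symmetry (inj₁ x) (inj₂ ((x , p , q) ,ᴿ e)) (inj₁ y) (inj₂ ((y , b , c) ,ᴿ d))
    align {x} {p} {q} [ x≢ ]
      -- The distinctness proofs are irrelevant and are recovered by deciding them.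
      with perm-3-transitive (recompute (distinct₃? (x , p , q)) x≢) (recompute (distinct₃? (y , b , c)) y≢)
    ... | π , refl , refl , refl = permute-symmetry π

    via : ∀ {x T} → x ∈ᵗ T → Symmetry (inj₁ x) (inj₂ T) (inj₁ y) (inj₂ ((y , b , c) ,ᴿ d))
    via fst = align _
    via snd = Symmetry-trans rotate-symmetry (align _)
    via trd = Symmetry-trans rotate-symmetry (Symmetry-trans rotate-symmetry (align _))

  node-edgeTransitive : Triple → EdgeTransitive graph
  node-edgeTransitive ((y , b , c) ,ᴿ d) = edgeTransitive {inj₁ y} {inj₂ ((y , b , c) ,ᴿ d)} λ
    { (point-triple x∈T) → inj₁ (flag-symmetry x∈T)
    ; (triple-point x∈T) → inj₂ (flag-symmetry x∈T)
    }

-- Every other point shares a triple with the point 0, completed by 1 or 2.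
points-connected : ∀ k → let open PointsAndTriples (3 + k) in Connected graph
points-connected k = connected λ u v → from-node u ◅◅ Star.reverse ~-symm (from-node v)
  where
  open PointsAndTriples (3 + k)

  third : ∀ {x : Fin (3 + k)} → x ≢ 0F → ∃[ y ] Distinct₃ (x , 0F , y)
  third {x} x≢0 with x ≟ 1F
  ... | yes refl = 2F , (λ ()) , (λ ()) , λ ()
  ... | no x≢1   = 1F , x≢0 , x≢1 , λ ()

  from-point : ∀ x → Star _~_ (inj₁ x) (inj₁ 0F)
  from-point x with x ≟ 0F
  ... | yes refl = ε
  ... | no x≢0 with third x≢0
  ...   | y , d = point-triple {T = (x , 0F , y) ,ᴿ [ d ]} fst ◅ triple-point snd ◅ ε

  from-node : ∀ u → Star _~_ u (inj₁ 0F)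
  from-node (inj₁ x) = from-point x
  from-node (inj₂ ((a , _) ,ᴿ _)) = triple-point fst ◅ from-point a

-- Parity of path positions

double : ℕ → ℕ
double zero    = zero
double (suc i) = suc (suc (double i))

data Half : ℕ → Set where
  even : ∀ i → Half (double i)
  odd  : ∀ i → Half (suc (double i))

half : ∀ t → Half t
half zero = even 0
half (suc t) with half t
... | even i = odd i
... | odd i  = even (suc i)

double-injective : ∀ {i j} → double i ≡ double j → i ≡ j
double-injective {zero}  {zero}  _  = refl
double-injective {suc i} {suc j} eq = cong suc (double-injective (ℕ.suc-injective (ℕ.suc-injective eq)))

double≢1+double : ∀ {i j} → double i ≢ suc (double j)
double≢1+double {suc i} {zero}  ()
double≢1+double {suc i} {suc j} eq = double≢1+double (ℕ.suc-injective (ℕ.suc-injective eq))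

i≤double : ∀ i → i ≤ double i
i≤double zero    = z≤n
i≤double (suc i) = s≤s (ℕ.m≤n⇒m≤1+n (i≤double i))

-- With Tᵢ = {i+1, i+2, zᵢ}, the path T₀, 2, T₁, 3, T₂, 4, … is induced because the zᵢ are not on it.
-- The neighbours 1, 2, 0 of T₀ lie in T₂, T₁, T₁ respectively, so it is trapped at T₀ once T₂ is interior.
module TrappedPath {ℓ : ℕ} (5≤ℓ : 5 ≤ ℓ) where

  open PointsAndTriples (3 + ℓ)

  -- With an irrelevant bound, points of equal index agree definitionally.
  pt : ∀ j → .(j < 3 + ℓ) → Fin (3 + ℓ)
  pt j j< = fromℕ< j<

  pt-injective : ∀ {i j} .(i< : i < 3 + ℓ) .(j< : j < 3 + ℓ) → pt i i< ≡ pt j j< → i ≡ j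
  pt-injective = fromℕ<-injective _ _

  -- The value 1 at 2 puts the point 1 into T₂; the default 0 puts the point 0 into T₁.
  z : ℕ → ℕ
  z 2 = 1
  z _ = 0

  -- Keeps the third entry of Tᵢ below the other two, which makes the entries distinct.
  z≤ : ∀ i → z i ≤ i
  z≤ 0 = z≤n
  z≤ 1 = z≤n
  z≤ 2 = s≤s z≤n
  z≤ (suc (suc (suc i))) = z≤n

  -- Keeps third entries off the path, whose points start at 2.
  z≤1 : ∀ i → z i ≤ 1
  z≤1 0 = z≤n
  z≤1 1 = z≤n
  z≤1 2 = s≤s z≤n
  z≤1 (suc (suc (suc i))) = z≤n

  bound : ∀ {i} → i ≤ ℓ → 2 + i < 3 + ℓ
  bound i≤ℓ = s≤s (s≤s (s≤s i≤ℓ))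

  bound₁ : ∀ {i} → i ≤ ℓ → 1 + i < 3 + ℓ
  bound₁ = ℕ.<⇒≤ ∘ bound

  bound₀ : ∀ {i} → i ≤ ℓ → z i < 3 + ℓ
  bound₀ {i} i≤ℓ = ℕ.≤-<-trans (z≤ i) (ℕ.<⇒≤ (bound₁ i≤ℓ))

  distinct : ∀ {i} (i≤ : i ≤ ℓ) → Distinct₃ (pt (1 + i) (bound₁ i≤) , pt (2 + i) (bound i≤) , pt (z i) (bound₀ i≤))
  distinct {i} i≤ =
    (λ eq → ℕ.<-irrefl (pt-injective (bound₁ i≤) (bound i≤) eq) (ℕ.n<1+n _)) ,
    (λ eq → ℕ.<-irrefl (≡-sym (pt-injective (bound₁ i≤) (bound₀ i≤) eq)) (s≤s (z≤ i))) ,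
    (λ eq → ℕ.<-irrefl (≡-sym (pt-injective (bound i≤) (bound₀ i≤) eq)) (s≤s (ℕ.m≤n⇒m≤1+n (z≤ i))))

  triple : ∀ i → .(i ≤ ℓ) → Triple
  triple i i≤ = (pt (1 + i) (bound₁ i≤) , pt (2 + i) (bound i≤) , pt (z i) (bound₀ i≤)) ,ᴿ [ distinct i≤ ]

  even≤ : ∀ {i} → double i ≤ ℓ → i ≤ ℓ
  even≤ = ℕ.≤-trans (i≤double _)

  odd< : ∀ {i} → suc (double i) ≤ ℓ → 2 + i < 3 + ℓ
  odd< = bound ∘ even≤ ∘ ℕ.<⇒≤

  node : ∀ {t} → Half t → .(t ≤ ℓ) → Node
  node (even i) t≤ = inj₂ (triple i (even≤ t≤))
  node (odd i)  t≤ = inj₁ (pt (2 + i) (odd< t≤))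

  node-injective : ∀ {s t} (h : Half s) (h′ : Half t) .(s≤ : s ≤ ℓ) .(t≤ : t ≤ ℓ) →
    node h s≤ ≡ node h′ t≤ → s ≡ t
  node-injective (even i) (even j) s≤ t≤ eq = cong double (ℕ.suc-injective
    (pt-injective (bound₁ (even≤ s≤)) (bound₁ (even≤ t≤)) (cong (proj₁ ∘ value) (inj₂-injective eq))))
  node-injective (odd i)  (odd j)  s≤ t≤ eq = cong (suc ∘ double) (ℕ.suc-injective (ℕ.suc-injective
    (pt-injective (odd< s≤) (odd< t≤) (inj₁-injective eq))))
  node-injective (even i) (odd j)  _ _ ()
  node-injective (odd i)  (even j) _ _ ()

  Consecutive : ℕ → ℕ → Set
  Consecutive s t = suc s ≡ t ⊎ suc t ≡ s

  ∈-triple⁻ : ∀ {i j} .(i≤ : i ≤ ℓ) .(j< : 2 + j < 3 + ℓ) → pt (2 + j) j< ∈ᵗ triple i i≤ → j ≡ i ⊎ suc j ≡ i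
  ∈-triple⁻ {i} {j} i≤ j< x∈T = go (∈ᵗ⇒ x∈T)
    where
    go : _ → j ≡ i ⊎ suc j ≡ i
    go (inj₁ eq)        = inj₂ (ℕ.suc-injective (pt-injective j< (bound₁ i≤) eq))
    go (inj₂ (inj₁ eq)) = inj₁ (ℕ.suc-injective (ℕ.suc-injective (pt-injective j< (bound i≤) eq)))
    go (inj₂ (inj₂ eq)) = ⊥-elim (ℕ.<-irrefl (≡-sym (pt-injective j< (bound₀ i≤) eq))
      (s≤s (ℕ.≤-trans (z≤1 i) (s≤s z≤n))))

  ∈-triple⁺ : ∀ {i j} .(i≤ : i ≤ ℓ) .(j< : 2 + j < 3 + ℓ) → j ≡ i ⊎ suc j ≡ i → pt (2 + j) j< ∈ᵗ triple i i≤
  ∈-triple⁺ _ _ (inj₁ refl) = snd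
  ∈-triple⁺ _ _ (inj₂ refl) = fst

  flag-index⁺ : ∀ {i j} → j ≡ i ⊎ suc j ≡ i → Consecutive (double i) (suc (double j))
  flag-index⁺ (inj₁ refl) = inj₁ refl
  flag-index⁺ (inj₂ refl) = inj₂ refl

  flag-index⁻ : ∀ {i j} → Consecutive (double i) (suc (double j)) → j ≡ i ⊎ suc j ≡ i
  flag-index⁻ (inj₁ eq) = inj₁ (≡-sym (double-injective (ℕ.suc-injective eq)))
  flag-index⁻ (inj₂ eq) = inj₂ (double-injective eq)

  node-~⁻ : ∀ {s t} (h : Half s) (h′ : Half t) .(s≤ : s ≤ ℓ) .(t≤ : t ≤ ℓ) →
    node h s≤ ~ node h′ t≤ → Consecutive s t
  node-~⁻ (even i) (odd j)  s≤ t≤ (triple-point x∈T) =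
    flag-index⁺ (∈-triple⁻ {i} {j} (even≤ s≤) (odd< t≤) x∈T)
  node-~⁻ (odd j)  (even i) s≤ t≤ (point-triple x∈T) =
    Sum.swap (flag-index⁺ (∈-triple⁻ {i} {j} (even≤ t≤) (odd< s≤) x∈T))

  node-~⁺ : ∀ {s t} (h : Half s) (h′ : Half t) .(s≤ : s ≤ ℓ) .(t≤ : t ≤ ℓ) →
    Consecutive s t → node h s≤ ~ node h′ t≤
  node-~⁺ (even i) (odd j)  s≤ t≤ c = triple-point (∈-triple⁺ (even≤ s≤) (odd< t≤) (flag-index⁻ c))
  node-~⁺ (odd j)  (even i) s≤ t≤ c = point-triple (∈-triple⁺ (even≤ t≤) (odd< s≤) (flag-index⁻ (Sum.swap c)))
  node-~⁺ (even i) (even j) _ _ (inj₁ eq) = ⊥-elim (double≢1+double (≡-sym eq))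
  node-~⁺ (even i) (even j) _ _ (inj₂ eq) = ⊥-elim (double≢1+double (≡-sym eq))
  node-~⁺ (odd i)  (odd j)  _ _ (inj₁ eq) = ⊥-elim (double≢1+double (≡-sym (ℕ.suc-injective eq)))
  node-~⁺ (odd i)  (odd j)  _ _ (inj₂ eq) = ⊥-elim (double≢1+double (≡-sym (ℕ.suc-injective eq)))

  index≤ : (i : Fin (suc ℓ)) → toℕ i ≤ ℓ
  index≤ i = s≤s⁻¹ (toℕ<n i)

  path : Fin (suc ℓ) → Node
  path i = node (half (toℕ i)) (index≤ i)

  path-induced : IsInducedPath graph ℓ _
  path-induced = inducedPath path
    (λ {i} {j} eq → toℕ-injective (node-injective (half (toℕ i)) (half (toℕ j)) (index≤ i) (index≤ j) eq))
    (λ {i} {j} → mk⇔ (node-~⁻ (half (toℕ i)) (half (toℕ j)) (index≤ i) (index≤ j))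
                     (node-~⁺ (half (toℕ i)) (half (toℕ j)) (index≤ i) (index≤ j)))

  interior : ∀ {t} → suc t < ℓ → ∃[ i ] (toℕ i ≡ suc t × Interior {ℓ} i)
  interior {t} 1+t<ℓ =
    fromℕ< i< , toℕ-fromℕ< i< ,
    fromℕ< h< , fromℕ< j< ,
    trans (cong suc (toℕ-fromℕ< h<)) (≡-sym (toℕ-fromℕ< i<)) ,
    trans (cong suc (toℕ-fromℕ< i<)) (≡-sym (toℕ-fromℕ< j<))
    where
    j< : suc (suc t) < suc ℓ
    j< = s≤s 1+t<ℓ
    i< : suc t < suc ℓ
    i< = ℕ.<⇒≤ j<
    h< : t < suc ℓ
    h< = ℕ.<⇒≤ i<

  meets-interior : ∀ {x t} → suc t < ℓ → (∀ .(t≤ : suc t ≤ ℓ) → x ~ node (half (suc t)) t≤) →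
    ∃[ i ] (Interior i × x ~ path i)
  meets-interior {x} 1+t<ℓ x~ with interior 1+t<ℓ
  ... | i , i≡ , int = i , int , at (toℕ i) i≡ (index≤ i)
    where
    -- The index equals `suc t` only propositionally, so it is generalised before matching on the
    -- equation.
    at : ∀ s → s ≡ _ → .(s≤ : s ≤ ℓ) → x ~ node (half s) s≤
    at _ refl s≤ = x~ s≤

  path-trapped : ∀ {x} → path zero ~ x → ∃[ i ] (Interior i × x ~ path i)
  -- The point 1 is met by T₂ at position 4, interior because of `5≤ℓ`; the points 2 and 0 are met
  -- by T₁ at position 2.
  path-trapped (triple-point fst) = meets-interior 5≤ℓ λ _ → point-triple trd
  path-trapped (triple-point snd) = meets-interior (ℕ.≤-trans (s≤s (s≤s (s≤s z≤n))) 5≤ℓ) λ _ → point-triple fst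
  path-trapped (triple-point trd) = meets-interior (ℕ.≤-trans (s≤s (s≤s (s≤s z≤n))) 5≤ℓ) λ _ → point-triple trd

  nonclosingPath : HasNonclosingPath ℓ
  nonclosingPath = _ , graph , points-connected ℓ , node-edgeTransitive (triple 0 z≤n) , _ , path-induced ,
    trapped⇒¬closes graph path-induced (trapped path path-trapped)

theorem1p9 : ((n : ℕ) (G : Graph n) → Connected G → EdgeTransitive G → ¬ IsStar G →
    (ℓ : ℕ) → ℓ ≤ 3 → (p : Fin (suc ℓ) → Fin n) →
    IsInducedPath G ℓ p → ClosesToInducedCycle G ℓ p)
    ×
    ((ℓ : ℕ) → 4 ≤ ℓ →
    ∃[ n ] Σ (Graph n) λ G → Connected G × EdgeTransitive G ×
    Σ (Fin (suc ℓ) → Fin n) λ p →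
    IsInducedPath G ℓ p × ¬ ClosesToInducedCycle G ℓ p)
theorem1p9 = (λ n G → InducedPaths.short-inducedPath-closes G) , long
  where
  long : ∀ ℓ → 4 ≤ ℓ → HasNonclosingPath ℓ
  long ℓ 4≤ℓ with ℕ.m≤n⇒m<n∨m≡n 4≤ℓ
  ... | inj₁ 5≤ℓ  = TrappedPath.nonclosingPath 5≤ℓ
  -- For ℓ = 4 the triple T₂ would be the end of the path instead of an interior vertex, so the
  -- Paley graph takes over.
  ... | inj₂ refl = nonclosingPath₄
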